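{- The Only Upper Bounded Days On Days Off Scheduling Problem (UDODOSP) can be decided in $\mathcal{O}(D^2)$ time.
   Context: An instance of the Days On Days Off Scheduling Problem (DODOSP) consists of integers $D\ge 1$ (days), $N\ge 1$ (workers), bounds $l_w,u_w,l_o,u_o,U_w,U_o\in\mathbb{N}$, and for each day $d\in\{1,\dots,D\}$ integers $0\le r_l^d\le r_u^d\le N$. A schedule is a map $f:\{n_1,\dots,n_N\}\times\{1,\dots,D\}\to\{\mathrm{ON},\mathrm{OFF}\}$ (not cyclic). A work period (resp. off period) of a worker is an inclusion-wise maximal set of consecutive days on which the worker is ON (resp. OFF). A schedule is feasible if on every day $d$ the number of workers that are ON lies in $[r_l^d,r_u^d]$, every work period has length between $l_w$ and $u_w$, every off period has length between $l_o$ and $u_o$, every worker is ON on at most $U_w$ days and OFF on at most $U_o$ days. The decision problem asks whether a feasible schedule exists. The UDODOSP is the DODOSP restricted to instances with $l_w=l_o=1$. -}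

module Defs where

open import Data.Bool.Base using (if_then_else_)
open import Data.Fin.Base as Fin using (Fin; toℕ)
open import Data.List.Base as List using (List; []; _∷_; _++_)
open import Data.Nat.Base using (ℕ; zero; suc; _+_; _*_; _∸_; _≤_)
open import Data.Nat.Properties using (_≟_)
open import Data.Product.Base using (Σ; ∃-syntax; _×_)
open import Data.Sum.Base using (_⊎_)
open import Data.Vec.Base as Vec using (count; allFin)
open import Relation.Binary.Definitions using (DecidableEquality)
open import Relation.Binary.PropositionalEquality.Core using (_≡_; _≢_; refl)
open import Relation.Nullary.Decidable.Core using (yes; no; does)
open import Relation.Nullary.Negation.Core using (¬_)

------------------------------------------------------------------------
-- The scheduling problem

data Status : Set where
  ON OFF : Status

infix 4 _≟ˢ_
_≟ˢ_ : DecidableEquality Status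
ON  ≟ˢ ON  = yes refl
ON  ≟ˢ OFF = no λ ()
OFF ≟ˢ ON  = no λ ()
OFF ≟ˢ OFF = yes refl

-- Superscript w/o on a bound stands for work/off; rˡ and rᵘ are the daily
-- lower and upper staffing requirements.  Days and workers count from 0.
record DODOSP : Set where
  field
    D N               : ℕ
    lʷ uʷ lᵒ uᵒ Uʷ Uᵒ : ℕ
    rˡ rᵘ             : Fin D → ℕ
    1≤D               : 1 ≤ D
    1≤N               : 1 ≤ N
    rˡ≤rᵘ             : ∀ d → rˡ d ≤ rᵘ d
    rᵘ≤N              : ∀ d → rᵘ d ≤ N

OnlyUpperBounded : DODOSP → Set
OnlyUpperBounded I = lʷ ≡ 1 × lᵒ ≡ 1
  where open DODOSP I

UDODOSP : Set
UDODOSP = Σ DODOSP OnlyUpperBounded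

Constant : ∀ {D} → (Fin D → Status) → Status → Fin D → Fin D → Set
Constant row x a b = ∀ d → a Fin.≤ d → d Fin.≤ b → row d ≡ x

-- A nonempty set of consecutive days is given by its first day a and last
-- day b; such a set is contained in that of a′ , b′ iff a′ ≤ a and b ≤ b′.
record Period {D} (row : Fin D → Status) (x : Status) (a b : Fin D) : Set where
  field
    ordered  : a Fin.≤ b
    constant : Constant row x a b
    maximal  : ∀ a′ b′ → a′ Fin.≤ a → b Fin.≤ b′ →
               Constant row x a′ b′ → a′ ≡ a × b′ ≡ b

periodLength : ∀ {D} → Fin D → Fin D → ℕ
periodLength a b = suc (toℕ b ∸ toℕ a)

Schedule : DODOSP → Set
Schedule I = Fin N → Fin D → Status
  where open DODOSP I

module _ (I : DODOSP) (f : Schedule I) where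
  open DODOSP I

  workersOn : Fin D → ℕ
  workersOn d = count (λ n → f n d ≟ˢ ON) (allFin N)

  daysWith : Status → Fin N → ℕ
  daysWith x n = count (λ d → f n d ≟ˢ x) (allFin D)

  record Feasible : Set where
    field
      staffing    : ∀ d → rˡ d ≤ workersOn d × workersOn d ≤ rᵘ d
      workPeriods : ∀ n a b → Period (f n) ON a b →
                    lʷ ≤ periodLength a b × periodLength a b ≤ uʷ
      offPeriods  : ∀ n a b → Period (f n) OFF a b →
                    lᵒ ≤ periodLength a b × periodLength a b ≤ uᵒ
      totalWork   : ∀ n → daysWith ON n ≤ Uʷ
      totalOff    : ∀ n → daysWith OFF n ≤ Uᵒ

HasFeasibleSchedule : DODOSP → Set
HasFeasibleSchedule I = ∃[ f ] Feasible I f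

encode : DODOSP → List ℕ
encode I = D ∷ N ∷ lʷ ∷ uʷ ∷ lᵒ ∷ uᵒ ∷ Uʷ ∷ Uᵒ ∷
           List.tabulate rˡ ++ List.tabulate rᵘ
  where open DODOSP I

------------------------------------------------------------------------
-- Uniform-cost random access machine, with structured control flow
--
-- A program is a fixed finite text, so it mentions finitely many registers;
-- data of unbounded size lives in the memory, reached through load and
-- store.  Arithmetic is addition and truncated subtraction only: with a
-- unit-cost multiplication, repeated squaring would make numbers grow
-- doubly exponentially in the running time.

Reg : Set
Reg = ℕ

infixr 5 _⨾_
data Program : Set where
  _≔_      : Reg → ℕ → Program
  _≔_⊕_    : Reg → Reg → Reg → Program
  _≔_⊖_    : Reg → Reg → Reg → Program
  _≔mem[_] : Reg → Reg → Program
  mem[_]≔_ : Reg → Reg → Program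
  skip     : Program
  _⨾_      : Program → Program → Program
  -- Both tests ask whether the register is nonzero.
  if≢0     : Reg → Program → Program → Program
  while≢0  : Reg → Program → Program

_[_↦_] : (ℕ → ℕ) → ℕ → ℕ → (ℕ → ℕ)
(g [ i ↦ v ]) j = if does (j ≟ i) then v else g j

record State : Set where
  constructor ⟪_,_⟫
  field
    reg mem : ℕ → ℕ

-- ⟨ p , s ⟩⇓[ t ] s′ : started in s, p halts in s′ after t steps.  Every
-- executed instruction and every evaluated test takes one step.
data ⟨_,_⟩⇓[_]_ : Program → State → ℕ → State → Set where
  ⇓const : ∀ {r m i k} →
           ⟨ i ≔ k , ⟪ r , m ⟫ ⟩⇓[ 1 ] ⟪ r [ i ↦ k ] , m ⟫
  ⇓add   : ∀ {r m i j k} →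
           ⟨ i ≔ j ⊕ k , ⟪ r , m ⟫ ⟩⇓[ 1 ] ⟪ r [ i ↦ r j + r k ] , m ⟫
  ⇓sub   : ∀ {r m i j k} →
           ⟨ i ≔ j ⊖ k , ⟪ r , m ⟫ ⟩⇓[ 1 ] ⟪ r [ i ↦ r j ∸ r k ] , m ⟫
  ⇓load  : ∀ {r m i j} →
           ⟨ i ≔mem[ j ] , ⟪ r , m ⟫ ⟩⇓[ 1 ] ⟪ r [ i ↦ m (r j) ] , m ⟫
  ⇓store : ∀ {r m i j} →
           ⟨ mem[ i ]≔ j , ⟪ r , m ⟫ ⟩⇓[ 1 ] ⟪ r , m [ r i ↦ r j ] ⟫
  ⇓skip  : ∀ {s} → ⟨ skip , s ⟩⇓[ 1 ] s
  ⇓seq   : ∀ {p q s s′ s″ t u} →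
           ⟨ p , s ⟩⇓[ t ] s′ → ⟨ q , s′ ⟩⇓[ u ] s″ →
           ⟨ p ⨾ q , s ⟩⇓[ t + u ] s″
  ⇓then  : ∀ {i p q s s′ t} → State.reg s i ≢ 0 →
           ⟨ p , s ⟩⇓[ t ] s′ → ⟨ if≢0 i p q , s ⟩⇓[ suc t ] s′
  ⇓else  : ∀ {i p q s s′ t} → State.reg s i ≡ 0 →
           ⟨ q , s ⟩⇓[ t ] s′ → ⟨ if≢0 i p q , s ⟩⇓[ suc t ] s′
  ⇓loop  : ∀ {i p s s′ s″ t u} → State.reg s i ≢ 0 →
           ⟨ p , s ⟩⇓[ t ] s′ → ⟨ while≢0 i p , s′ ⟩⇓[ u ] s″ →
           ⟨ while≢0 i p , s ⟩⇓[ suc (t + u) ] s″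
  ⇓exit  : ∀ {i p s} → State.reg s i ≡ 0 →
           ⟨ while≢0 i p , s ⟩⇓[ 1 ] s

cells : List ℕ → ℕ → ℕ
cells []       _       = 0
cells (x ∷ xs) zero    = x
cells (x ∷ xs) (suc i) = cells xs i

initial : List ℕ → State
initial input = ⟪ (λ _ → 0) , cells input ⟫

-- The verdict is left in register 0.
Answers : Set → State → Set
Answers Q s = (Q × State.reg s 0 ≡ 1) ⊎ (¬ Q × State.reg s 0 ≡ 0)

-- One program and one constant serve all instances: in particular the
-- constant may not depend on any parameter that g ignores.
DecidableInO : {A : Set} → (A → List ℕ) → (A → Set) → (A → ℕ) → Set
DecidableInO {A} enc Q g =
  ∃[ p ] ∃[ c ] ((x : A) → ∃[ t ] ∃[ s ]
    (⟨ p , initial (enc x) ⟩⇓[ t ] s) × Answers (Q x) s × t ≤ c * g x)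

{-# OPTIONS --safe #-}
-- Let X d be the number of (worker, day) pairs before day d at which the
-- worker is ON.  The requirements on a single worker bound differences of its
-- prefix counts, so summing over the workers gives a system of difference
-- constraints on X.  Conversely, from a solution X worker n gets the prefix
-- counts ⌊(X d + n) / N⌋: rounding preserves difference bounds that are
-- multiples of N, and by Hermite's identity the counts add up to X d again.
-- The system has D + 1 unknowns and O(D) constraints, and the Bellman–Ford
-- algorithm solves it in D + 1 sweeps; the instance is feasible iff one more
-- sweep changes nothing.
module Submission where

open import Defs
open import Data.Bool.Base using (if_then_else_)
open import Data.Empty using (⊥)
open import Data.Fin.Base as Fin using (Fin; zero; suc; toℕ; fromℕ<)
open import Data.Fin.Properties
  using (toℕ-fromℕ<; toℕ<n; toℕ≤n; toℕ-injective; toℕ-inject₁; toℕ-fromℕ)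
open import Data.List.Base as List using (List; []; _∷_; _++_; length)
open import Data.List.Properties using (++-identityʳ; length-++; length-tabulate)
open import Data.List.Relation.Unary.All as All using (All; []; _∷_)
open import Data.List.Relation.Unary.All.Properties using (++⁺; ++⁻ˡ; ++⁻ʳ)
open import Data.Nat.Base
open import Data.Nat.DivMod
open import Data.Nat.Divisibility using (n∣m*n)
open import Data.Nat.Properties
open import Data.Nat.Tactic.RingSolver using (solve-∀)
open import Data.Product.Base
open import Data.Sum.Base using (inj₁; inj₂)
open import Data.Unit.Base using (⊤)
open import Data.Vec.Base as Vec using (tabulate)
open import Function.Base using (_∘_; id)
open import Relation.Binary.PropositionalEquality
open import Relation.Nullary
open import Relation.Nullary.Decidable using (dec-true; dec-false)
open import Algebra.Properties.Semiring.Sum +-*-semiring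
  using (sum; sum-cong-≗; ∑-distrib-+; sum-replicate-zero; sum-init-last)

-- Sums and prefix counts

-- Periods of length at most `u` mean that no `u + 1` consecutive days share the status, which
-- bounds one difference of prefix counts. A bound from below would be conditional on a period
-- starting; at the value 1 it holds because periods are nonempty. OFF days are complements of ON
-- days, so one family of unknowns suffices. Constraints have the form `X s + g ∸ l ≤ X t`, and
-- relaxation raises `X t`. Starting from 0, the unknowns climb and stay below every solution, so
-- natural numbers with truncated subtraction are enough, without infinity or a source vertex.
-- Convergence is proved without paths or cycles: fix any solution above the memory and count the
-- unknowns still below it. Either a sweep lowers this count, or the solution can be replaced by a
-- smaller one. The time may depend neither on `N` nor on the size of the bounds, and the machine
-- cannot multiply. Multiples of `N` are therefore built by repeated addition, with multipliers
-- capped at `D`.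

sum-mono-≤ : ∀ {n} {g h : Fin n → ℕ} → (∀ i → g i ≤ h i) → sum g ≤ sum h
sum-mono-≤ {zero}  g≤h = z≤n
sum-mono-≤ {suc n} g≤h = +-mono-≤ (g≤h zero) (sum-mono-≤ (g≤h ∘ suc))

sum-const : ∀ n c → sum {n} (λ _ → c) ≡ n * c
sum-const zero    c = refl
sum-const (suc n) c = cong (c +_) (sum-const n c)

sum-squeeze : ∀ {n} {g h : Fin n → ℕ} → (∀ i → g i ≤ h i) → sum h ≤ sum g → ∀ i → h i ≤ g i
sum-squeeze {suc n} {g} {h} g≤h Σh≤Σg zero =
  +-cancelʳ-≤ _ (h zero) (g zero)
    (≤-trans (+-monoʳ-≤ (h zero) (sum-mono-≤ (g≤h ∘ suc))) Σh≤Σg)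
sum-squeeze {suc n} {g} {h} g≤h Σh≤Σg (suc i) =
  sum-squeeze (g≤h ∘ suc)
    (+-cancelˡ-≤ (g zero) _ _ (≤-trans (+-monoˡ-≤ _ (g≤h zero)) Σh≤Σg)) i

hit : Status → Status → ℕ
hit ON  ON  = 1
hit ON  OFF = 0
hit OFF ON  = 0
hit OFF OFF = 1

hit-self : ∀ x → hit x x ≡ 1
hit-self ON  = refl
hit-self OFF = refl

hit-≤1 : ∀ x y → hit x y ≤ 1
hit-≤1 ON  ON  = ≤-refl
hit-≤1 ON  OFF = z≤n
hit-≤1 OFF ON  = z≤n
hit-≤1 OFF OFF = ≤-refl

hit-≢ : ∀ x y → y ≢ x → hit x y ≡ 0
hit-≢ ON  ON  y≢x = contradiction refl y≢x
hit-≢ ON  OFF _   = refl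
hit-≢ OFF ON  _   = refl
hit-≢ OFF OFF y≢x = contradiction refl y≢x

count-hit : ∀ x {A : Set} {n} (g : A → Status) (h : Fin n → A) →
            Vec.count (λ a → g a ≟ˢ x) (tabulate h) ≡ sum (λ i → hit x (g (h i)))
count-hit x {n = zero}  g h = refl
count-hit x {n = suc n} g h with x | g (h zero) | count-hit x g (h ∘ suc)
... | ON  | ON  | eq = cong suc eq
... | ON  | OFF | eq = eq
... | OFF | ON  | eq = eq
... | OFF | OFF | eq = cong suc eq

prefix : ∀ {D} → Status → (Fin D → Status) → ℕ → ℕ
prefix {zero}  x row d       = 0
prefix {suc D} x row zero    = 0
prefix {suc D} x row (suc d) = hit x (row zero) + prefix x (row ∘ suc) d

prefix-zero : ∀ {D} x (row : Fin D → Status) → prefix x row 0 ≡ 0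
prefix-zero {zero}  x row = refl
prefix-zero {suc D} x row = refl

prefix-suc : ∀ {D} x (row : Fin D → Status) i →
             prefix x row (suc (toℕ i)) ≡ prefix x row (toℕ i) + hit x (row i)
prefix-suc {suc D} x row zero    =
  trans (cong (hit x (row zero) +_) (prefix-zero x (row ∘ suc))) (+-identityʳ _)
prefix-suc {suc D} x row (suc i) =
  trans (cong (hit x (row zero) +_) (prefix-suc x (row ∘ suc) i))
    (sym (+-assoc (hit x (row zero)) _ _))

prefix-all : ∀ {D} x (row : Fin D → Status) → prefix x row D ≡ sum (λ i → hit x (row i))
prefix-all {zero}  x row = refl
prefix-all {suc D} x row = cong (hit x (row zero) +_) (prefix-all x (row ∘ suc))

prefix-on+off : ∀ {D} (row : Fin D → Status) {d} → d ≤ D →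
                prefix ON row d + prefix OFF row d ≡ d
prefix-on+off {zero}  row z≤n = refl
prefix-on+off {suc D} row {zero}  _ = refl
prefix-on+off {suc D} row {suc d} (s≤s d≤D) with row zero | prefix-on+off (row ∘ suc) d≤D
... | ON  | eq = cong suc eq
... | OFF | eq = trans (+-suc _ _) (cong suc eq)

-- Bounded periods as bounds on windows of days

module _ {D} (x : Status) (row : Fin D → Status) where

  private
    q : ℕ → ℕ
    q = prefix x row

  prefix-step : ∀ {d} (d<D : d < D) → q (suc d) ≡ q d + hit x (row (fromℕ< d<D))
  prefix-step d<D = subst (λ d → q (suc d) ≡ q d + hit x (row (fromℕ< d<D)))
                      (toℕ-fromℕ< d<D) (prefix-suc x row (fromℕ< d<D))

  prefix-lipschitz : ∀ d k → d + k ≤ D → q (d + k) ≤ q d + k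
  prefix-lipschitz d zero    _  rewrite +-identityʳ d | +-identityʳ (q d) = ≤-refl
  prefix-lipschitz d (suc k) le rewrite +-suc d k = begin
    q (suc (d + k))
      ≡⟨ prefix-step le ⟩
    q (d + k) + hit x (row (fromℕ< le))
      ≤⟨ +-mono-≤ (prefix-lipschitz d k (<⇒≤ le)) (hit-≤1 x _) ⟩
    q d + k + 1
      ≡⟨ +-assoc (q d) k 1 ⟩
    q d + (k + 1)
      ≡⟨ cong (q d +_) (+-comm k 1) ⟩
    q d + suc k ∎
    where open ≤-Reasoning

  prefix-constant : ∀ (a b : Fin D) → Constant row x a b → ∀ k → toℕ a + k ≤ suc (toℕ b) →
                    q (toℕ a + k) ≡ q (toℕ a) + k
  prefix-constant a b const zero    _  rewrite +-identityʳ (toℕ a) | +-identityʳ (q (toℕ a)) = refl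
  prefix-constant a b const (suc k) le rewrite +-suc (toℕ a) k = begin
    q (suc (toℕ a + k))                      ≡⟨ prefix-step c<D ⟩
    q (toℕ a + k) + hit x (row c)            ≡⟨ cong₂ (λ v y → v + hit x y)
                                                  (prefix-constant a b const k (m≤n⇒m≤1+n (s≤s⁻¹ le)))
                                                  (const c a≤c c≤b) ⟩
    q (toℕ a) + k + hit x x                  ≡⟨ cong (q (toℕ a) + k +_) (hit-self x) ⟩
    q (toℕ a) + k + 1                        ≡⟨ +-assoc (q (toℕ a)) k 1 ⟩
    q (toℕ a) + (k + 1)                      ≡⟨ cong (q (toℕ a) +_) (+-comm k 1) ⟩
    q (toℕ a) + suc k                        ∎
    where
    open ≡-Reasoning
    c<D : toℕ a + k < D
    c<D = ≤-trans le (toℕ<n b)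
    c : Fin D
    c = fromℕ< c<D
    a≤c : toℕ a ≤ toℕ c
    a≤c = ≤-trans (m≤m+n (toℕ a) k) (≤-reflexive (sym (toℕ-fromℕ< c<D)))
    c≤b : toℕ c ≤ toℕ b
    c≤b = ≤-trans (≤-reflexive (toℕ-fromℕ< c<D)) (s≤s⁻¹ le)

  -- `ShortRuns` looks at windows of `u + 1` days and, unlike `ShortPeriods`, only compares two
  -- prefix counts; this is the form that can be summed over the workers.
  ShortPeriods ShortRuns : ℕ → Set
  ShortPeriods u = ∀ a b → Period row x a b → periodLength a b ≤ u
  ShortRuns u    = ∀ d → suc (d + u) ≤ D → q (suc (d + u)) ≤ q d + u

  ShortRuns⇒ShortPeriods : ∀ {u} → ShortRuns u → ShortPeriods u
  ShortRuns⇒ShortPeriods {u} short a b period = ≮⇒≥ λ u<len →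
    let a+u≤b = subst (toℕ a + u ≤_) (m+[n∸m]≡n ordered) (+-monoʳ-≤ (toℕ a) (s≤s⁻¹ u<len))
        grown = prefix-constant a b constant (suc u)
                  (≤-trans (≤-reflexive (+-suc (toℕ a) u)) (s≤s a+u≤b))
    in 1+n≰n (begin
         suc (q (toℕ a) + u)    ≡⟨ +-suc (q (toℕ a)) u ⟨
         q (toℕ a) + suc u      ≡⟨ grown ⟨
         q (toℕ a + suc u)      ≡⟨ cong q (+-suc (toℕ a) u) ⟩
         q (suc (toℕ a + u))    ≤⟨ short (toℕ a) (≤-trans (s≤s a+u≤b) (toℕ<n b)) ⟩
         q (toℕ a) + u          ∎)
    where
    open Period period
    open ≤-Reasoning

  -- A constant stretch that is not a period extends to a longer one.
  stretch-≤ : ∀ {u} → ShortPeriods u → ∀ k {a b} → a Fin.≤ b → D ≤ k + (toℕ b ∸ toℕ a) →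
              Constant row x a b → periodLength a b ≤ u
  stretch-≤ short zero {a} {b} a≤b D≤ const =
    contradiction (≤-trans D≤ (m∸n≤m (toℕ b) (toℕ a))) (<⇒≱ (toℕ<n b))
  stretch-≤ {u} short (suc k) {a} {b} a≤b D≤ const = ≮⇒≥ λ u<len →
    -- `k` bounds how much the stretch can still lengthen, as its extent stays below `D`. By
    -- induction a strictly longer stretch has length at most `u`, which the present one already
    -- exceeds.
    let absurd : ∀ {a′ b′} → a′ Fin.≤ b′ → Constant row x a′ b′ →
                 toℕ b ∸ toℕ a < toℕ b′ ∸ toℕ a′ → ⊥
        absurd a′≤b′ const′ longer = <⇒≱ (≤-trans u<len longer)
          (<⇒≤ (stretch-≤ short k a′≤b′
            (≤-trans D≤ (≤-trans (≤-reflexive (sym (+-suc k _))) (+-monoʳ-≤ k longer))) const′))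
    in <⇒≱ u<len (short a b record
      { ordered  = a≤b
      ; constant = const
      ; maximal  = λ a′ b′ a′≤a b≤b′ const′ →
          let a′≤b′ = ≤-trans a′≤a (≤-trans a≤b b≤b′) in
          toℕ-injective (≤-antisym a′≤a (≮⇒≥ λ a′<a → absurd a′≤b′ const′
            (≤-<-trans (∸-monoˡ-≤ (toℕ a) b≤b′) (∸-monoʳ-< a′<a (≤-trans a≤b b≤b′)))))
        , toℕ-injective (≤-antisym (≮⇒≥ λ b<b′ → absurd a′≤b′ const′
            (<-≤-trans (∸-monoˡ-< b<b′ a≤b) (∸-monoʳ-≤ (toℕ b′) a′≤a))) b≤b′)
      })

  -- If a window of `u + 1` days gains more than `u`, none of its days has the other status: such a
  -- day would leave two parts of `u` days together, each gaining at most its length. So the window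
  -- is a constant stretch that is too long.
  ShortPeriods⇒ShortRuns : ∀ {u} → ShortPeriods u → ShortRuns u
  ShortPeriods⇒ShortRuns {u} short d le = ≮⇒≥ λ grows →
    1+n≰n (subst (_≤ u) length≡ (stretch-≤ short D a≤b (m≤m+n D _) (constant grows)))
    where
    d<D : d < D
    d<D = ≤-trans (s≤s (m≤m+n d u)) le
    a b : Fin D
    a = fromℕ< d<D
    b = fromℕ< le
    a≤b : a Fin.≤ b
    a≤b = subst₂ _≤_ (sym (toℕ-fromℕ< d<D)) (sym (toℕ-fromℕ< le)) (m≤m+n d u)
    length≡ : periodLength a b ≡ suc u
    length≡ = cong suc (trans (cong₂ _∸_ (toℕ-fromℕ< le) (toℕ-fromℕ< d<D)) (m+n∸m≡n d u))

    constant : q d + u < q (suc (d + u)) → Constant row x a b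
    constant grows c a≤c c≤b with row c ≟ˢ x
    ... | yes eq = eq
    ... | no  ≢x = contradiction bounded (<⇒≱ grows)
      where
      open ≤-Reasoning
      d≤c : d ≤ toℕ c
      d≤c = subst (_≤ toℕ c) (toℕ-fromℕ< d<D) a≤c
      i j : ℕ
      i = toℕ c ∸ d
      j = d + u ∸ toℕ c
      d+i≡c : d + i ≡ toℕ c
      d+i≡c = m+[n∸m]≡n d≤c
      c+j≡d+u : toℕ c + j ≡ d + u
      c+j≡d+u = m+[n∸m]≡n (subst (toℕ c ≤_) (toℕ-fromℕ< le) c≤b)
      i+j≡u : i + j ≡ u
      i+j≡u = +-cancelˡ-≡ d _ _ (trans (sym (+-assoc d i j)) (trans (cong (_+ j) d+i≡c) c+j≡d+u))
      bounded : q (suc (d + u)) ≤ q d + u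
      bounded = begin
        q (suc (d + u))                 ≡⟨ cong (q ∘ suc) c+j≡d+u ⟨
        q (suc (toℕ c) + j)             ≤⟨ prefix-lipschitz (suc (toℕ c)) j
                                             (subst (_≤ D) (cong suc (sym c+j≡d+u)) le) ⟩
        q (suc (toℕ c)) + j             ≡⟨ cong (_+ j) (prefix-suc x row c) ⟩
        q (toℕ c) + hit x (row c) + j   ≡⟨ cong (λ h → q (toℕ c) + h + j) (hit-≢ x (row c) ≢x) ⟩
        q (toℕ c) + 0 + j               ≡⟨ cong (_+ j) (+-identityʳ (q (toℕ c))) ⟩
        q (toℕ c) + j                   ≡⟨ cong (λ c → q c + j) d+i≡c ⟨
        q (d + i) + j                   ≤⟨ +-monoˡ-≤ j (prefix-lipschitz d i
                                             (subst (_≤ D) (sym d+i≡c) (<⇒≤ (toℕ<n c)))) ⟩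
        q d + i + j                     ≡⟨ +-assoc (q d) i j ⟩
        q d + (i + j)                   ≡⟨ cong (q d +_) i+j≡u ⟩
        q d + u                         ∎

-- Schedules and difference constraints

-- D ∸ (D ∸ Uʷ) is the minimum of D and Uʷ.
record Profile (I : DODOSP) (X : ℕ → ℕ) : Set where
  open DODOSP I
  field
    lower : ∀ d → X (toℕ d) + rˡ d ≤ X (suc (toℕ d))
    upper : ∀ d → X (suc (toℕ d)) ≤ X (toℕ d) + rᵘ d
    off   : ∀ d → suc (d + uᵒ) ≤ D → X d + N ≤ X (suc (d + uᵒ))
    work  : ∀ d → suc (d + uʷ) ≤ D → X (suc (d + uʷ)) ≤ X d + uʷ * N
    least : X 0 + (D ∸ Uᵒ) * N ≤ X D
    most  : X D ≤ X 0 + (D ∸ (D ∸ Uʷ)) * N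

-- Here `a`, `b` and `c`, `e` are the ON and OFF counts at the two ends of a window of `u + 1` days:
-- one ON day in it leaves at most `u` OFF days.
complement-≤ : ∀ {a b c d e u} → a + b ≡ d → c + e ≡ suc (d + u) → a + 1 ≤ c → e ≤ b + u
complement-≤ {a} {b} {c} {e = e} {u} refl ce≡ le = +-cancelˡ-≤ c e (b + u) (begin
  c + e              ≡⟨ ce≡ ⟩
  suc (a + b + u)    ≡⟨ cong suc (+-assoc a b u) ⟩
  suc a + (b + u)    ≡⟨ cong (_+ (b + u)) (+-comm a 1) ⟨
  a + 1 + (b + u)    ≤⟨ +-monoˡ-≤ (b + u) le ⟩
  c + (b + u)        ∎)
  where open ≤-Reasoning

complement-≥ : ∀ {a b c d e u} → a + b ≡ d → c + e ≡ suc (d + u) → e ≤ b + u → a + 1 ≤ c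
complement-≥ {a} {b} {c} {e = e} {u} refl ce≡ le = +-cancelʳ-≤ (b + u) (a + 1) c (begin
  a + 1 + (b + u)    ≡⟨ cong (_+ (b + u)) (+-comm a 1) ⟩
  suc a + (b + u)    ≡⟨ cong suc (+-assoc a b u) ⟨
  suc (a + b + u)    ≡⟨ ce≡ ⟨
  c + e              ≤⟨ +-monoʳ-≤ c le ⟩
  c + (b + u)        ∎)
  where open ≤-Reasoning

-- A count of days never exceeds `D`, so capping a bound at `D` loses nothing; it keeps the
-- multiplier of `N` small enough for repeated addition.
cap-least : ∀ {v D U} → v ≤ D → v ≤ U → v ≤ D ∸ (D ∸ U)
cap-least {v} {D} v≤D v≤U =
  ≤-trans (≤-reflexive (sym (m∸[m∸n]≡n v≤D))) (∸-monoʳ-≤ D (∸-monoʳ-≤ D v≤U))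

cap-≤ : ∀ D U → D ∸ (D ∸ U) ≤ U
cap-≤ D U = m≤n+o⇒m∸n≤o D (D ∸ U) (≤-trans (m≤n+m∸n D U) (≤-reflexive (+-comm U (D ∸ U))))

module _ {I : DODOSP} {f : Schedule I} (feasible : Feasible I f) where
  open DODOSP I
  open Feasible feasible

  private
    p : Fin N → ℕ → ℕ
    p n = prefix ON (f n)

    X : ℕ → ℕ
    X d = sum (λ n → p n d)

    shifted-sum : ∀ d c → sum (λ n → p n d + c) ≡ X d + c * N
    shifted-sum d c = trans (∑-distrib-+ (λ n → p n d) (λ _ → c))
                        (cong (X d +_) (trans (sum-const N c) (*-comm N c)))

    grows : ∀ {d e c} → (∀ n → p n d + c ≤ p n e) → X d + c * N ≤ X e
    grows {d} {e} {c} le = ≤-trans (≤-reflexive (sym (shifted-sum d c))) (sum-mono-≤ le)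

    bounded : ∀ {d e c} → (∀ n → p n e ≤ p n d + c) → X e ≤ X d + c * N
    bounded {d} {e} {c} le = ≤-trans (sum-mono-≤ le) (≤-reflexive (shifted-sum d c))

    X-suc : ∀ d → X (suc (toℕ d)) ≡ X (toℕ d) + workersOn I f d
    X-suc d = begin
      sum (λ n → p n (suc (toℕ d)))               ≡⟨ sum-cong-≗ (λ n → prefix-suc ON (f n) d) ⟩
      sum (λ n → p n (toℕ d) + hit ON (f n d))    ≡⟨ ∑-distrib-+ (λ n → p n (toℕ d)) _ ⟩
      X (toℕ d) + sum (λ n → hit ON (f n d))
        ≡⟨ cong (X (toℕ d) +_) (count-hit ON (λ n → f n d) id) ⟨
      X (toℕ d) + workersOn I f d                 ∎
      where open ≡-Reasoning

    daysWith≡ : ∀ x n → daysWith I f x n ≡ prefix x (f n) D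
    daysWith≡ x n = trans (count-hit x (f n) id) (sym (prefix-all x (f n)))

    on+off : ∀ n → p n D + prefix OFF (f n) D ≡ D
    on+off n = prefix-on+off (f n) ≤-refl

  feasible⇒profile : ∃[ X ] Profile I X
  feasible⇒profile = X , record
    { lower = λ d → ≤-trans (+-monoʳ-≤ (X (toℕ d)) (proj₁ (staffing d)))
                      (≤-reflexive (sym (X-suc d)))
    ; upper = λ d → ≤-trans (≤-reflexive (X-suc d)) (+-monoʳ-≤ (X (toℕ d)) (proj₂ (staffing d)))
    ; off   = λ d le → subst (λ M → X d + M ≤ X (suc (d + uᵒ))) (*-identityˡ N) (grows λ n →
        complement-≥ (prefix-on+off (f n) (<⇒≤ (≤-trans (s≤s (m≤m+n d uᵒ)) le)))
          (prefix-on+off (f n) le)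
          (ShortPeriods⇒ShortRuns OFF (f n) (λ a b → proj₂ ∘ offPeriods n a b) d le))
    ; work  = λ d le → bounded λ n →
        ShortPeriods⇒ShortRuns ON (f n) (λ a b → proj₂ ∘ workPeriods n a b) d le
    ; least = grows λ n → subst (λ z → z + (D ∸ Uᵒ) ≤ p n D) (sym (prefix-zero ON (f n)))
        (m≤n+o⇒m∸n≤o D Uᵒ (begin
          D                               ≡⟨ on+off n ⟨
          p n D + prefix OFF (f n) D      ≡⟨ cong (p n D +_) (daysWith≡ OFF n) ⟨
          p n D + daysWith I f OFF n      ≤⟨ +-monoʳ-≤ (p n D) (totalOff n) ⟩
          p n D + Uᵒ                      ≡⟨ +-comm (p n D) Uᵒ ⟩
          Uᵒ + p n D                      ∎))
    ; most  = bounded λ n → ≤-trans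
        (cap-least (m+n≤o⇒m≤o (p n D) (≤-reflexive (on+off n)))
                   (subst (_≤ Uʷ) (daysWith≡ ON n) (totalWork n)))
        (m≤n+m _ (p n 0))
    }
    where open ≤-Reasoning

-- Hermite's identity and the rounded schedule

module _ (N : ℕ) .{{_ : NonZero N}} where

  [m+k*n]/n : ∀ m k → (m + k * N) / N ≡ m / N + k
  [m+k*n]/n m k = trans (+-distrib-/-∣ʳ m (n∣m*n k)) (cong (m / N +_) (m*n/n≡m k N))

  -- Passing from `x` to `suc x` shifts the summands along by one: `x / N` leaves and `(x + N) / N`,
  -- which is larger by one, enters.
  hermite : ∀ x → sum {N} (λ n → (x + toℕ n) / N) ≡ x
  hermite zero    = trans (sum-cong-≗ {N} (λ n → m<n⇒m/n≡0 (toℕ<n n))) (sum-replicate-zero N)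
  hermite (suc x) = +-cancelʳ-≡ (g 0) _ _ (begin
    sum {N} (λ n → (suc x + toℕ n) / N) + g 0
      ≡⟨ cong (_+ g 0) (sum-cong-≗ {N} (λ n → /-congˡ (sym (+-suc x (toℕ n))))) ⟩
    sum {N} (λ n → g (suc (toℕ n))) + g 0
      ≡⟨ +-comm _ (g 0) ⟩
    sum {suc N} (λ n → g (toℕ n))
      ≡⟨ sum-init-last {N} (λ n → g (toℕ n)) ⟩
    sum {N} (λ n → g (toℕ (Fin.inject₁ n))) + g (toℕ (Fin.fromℕ N))
      ≡⟨ cong₂ _+_ (sum-cong-≗ {N} (λ n → cong g (toℕ-inject₁ n))) (cong g (toℕ-fromℕ N)) ⟩
    sum {N} (λ n → g (toℕ n)) + g N
      ≡⟨ cong₂ _+_ (hermite x) gN ⟩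
    x + suc (g 0)
      ≡⟨ +-suc x (g 0) ⟩
    suc x + g 0 ∎)
    where
    open ≡-Reasoning
    g : ℕ → ℕ
    g k = (x + k) / N
    gN : g N ≡ suc (g 0)
    gN = begin
      (x + N) / N        ≡⟨ cong (λ M → (x + M) / N) (*-identityˡ N) ⟨
      (x + 1 * N) / N    ≡⟨ [m+k*n]/n x 1 ⟩
      x / N + 1          ≡⟨ +-comm (x / N) 1 ⟩
      suc (x / N)        ≡⟨ cong (λ y → suc (y / N)) (+-identityʳ x) ⟨
      suc (g 0)          ∎

accumulated : ∀ {D} {row : Fin D → Status} (P : ℕ → ℕ) →
              (∀ i → P (suc (toℕ i)) ≡ P (toℕ i) + hit ON (row i)) →
              ∀ d → d ≤ D → P d ≡ P 0 + prefix ON row d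
accumulated {row = row} P step zero    _   =
  sym (trans (cong (P 0 +_) (prefix-zero ON row)) (+-identityʳ (P 0)))
accumulated {row = row} P step (suc d) d<D = begin
  P (suc d)                          ≡⟨ cong (P ∘ suc) (toℕ-fromℕ< d<D) ⟨
  P (suc (toℕ i))                    ≡⟨ step i ⟩
  P (toℕ i) + hit ON (row i)         ≡⟨ cong (λ c → P c + hit ON (row i)) (toℕ-fromℕ< d<D) ⟩
  P d + hit ON (row i)               ≡⟨ cong (_+ hit ON (row i)) (accumulated P step d (<⇒≤ d<D)) ⟩
  P 0 + prefix ON row d + hit ON (row i)    ≡⟨ +-assoc (P 0) _ _ ⟩
  P 0 + (prefix ON row d + hit ON (row i))  ≡⟨ cong (P 0 +_) (prefix-step ON row d<D) ⟨
  P 0 + prefix ON row (suc d)        ∎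
  where
  open ≡-Reasoning
  i = fromℕ< d<D

module _ {I : DODOSP} (upper-only : OnlyUpperBounded I)
         {X : ℕ → ℕ} (profile : Profile I X) where
  open DODOSP I
  open Profile profile

  private
    instance
      N≢0 : NonZero N
      N≢0 = >-nonZero 1≤N

    P : Fin N → ℕ → ℕ
    P n d = (X d + toℕ n) / N

    rounded : Schedule I
    rounded n d with P n (suc (toℕ d)) ≤? P n (toℕ d)
    ... | yes _ = OFF
    ... | no  _ = ON

    shift : ∀ n d c → (X d + c * N + toℕ n) / N ≡ P n d + c
    shift n d c = trans (/-congˡ (trans (+-assoc (X d) _ _)
      (trans (cong (X d +_) (+-comm (c * N) (toℕ n))) (sym (+-assoc (X d) _ _)))))
      ([m+k*n]/n N (X d + toℕ n) c)

    grows : ∀ n {d e} c → X d + c * N ≤ X e → P n d + c ≤ P n e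
    grows n {d} c le =
      ≤-trans (≤-reflexive (sym (shift n d c))) (/-monoˡ-≤ N (+-monoˡ-≤ (toℕ n) le))

    bounded : ∀ n {d e} c → X e ≤ X d + c * N → P n e ≤ P n d + c
    bounded n {d} c le =
      ≤-trans (/-monoˡ-≤ N (+-monoˡ-≤ (toℕ n) le)) (≤-reflexive (shift n d c))

    -- The increments are 0 or 1, hence readable as statuses: `lower` makes `X` monotone, and
    -- `upper` with `rᵘ ≤ N` lets it grow by at most one multiple of `N` per day.
    P-suc : ∀ n d → P n (suc (toℕ d)) ≡ P n (toℕ d) + hit ON (rounded n d)
    P-suc n d with P n (suc (toℕ d)) ≤? P n (toℕ d)
    ... | yes le = trans (≤-antisym le (/-monoˡ-≤ N (+-monoˡ-≤ (toℕ n)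
                     (≤-trans (m≤m+n _ _) (lower d))))) (sym (+-identityʳ _))
    ... | no  ≰  = ≤-antisym (bounded n 1 (≤-trans (upper d) (+-monoʳ-≤ (X (toℕ d))
                     (≤-trans (rᵘ≤N d) (≤-reflexive (sym (*-identityˡ N)))))))
                     (≤-trans (≤-reflexive (+-comm _ 1)) (≰⇒> ≰))

    p : Fin N → ℕ → ℕ
    p n = prefix ON (rounded n)

    -- A profile does not force `X 0` to be 0, so the rounded values are prefix counts only up to
    -- the offset `P n 0`, which cancels in all differences.
    P≡p : ∀ n {d} → d ≤ D → P n d ≡ P n 0 + p n d
    P≡p n {d} = accumulated (P n) (P-suc n) d

    p-grows : ∀ n {d e} c → d ≤ D → e ≤ D → X d + c * N ≤ X e → p n d + c ≤ p n e
    p-grows n {d} {e} c d≤D e≤D le = +-cancelˡ-≤ (P n 0) _ _ (begin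
      P n 0 + (p n d + c)  ≡⟨ +-assoc (P n 0) _ _ ⟨
      P n 0 + p n d + c    ≡⟨ cong (_+ c) (P≡p n d≤D) ⟨
      P n d + c            ≤⟨ grows n c le ⟩
      P n e                ≡⟨ P≡p n e≤D ⟩
      P n 0 + p n e        ∎)
      where open ≤-Reasoning

    p-bounded : ∀ n {d e} c → d ≤ D → e ≤ D → X e ≤ X d + c * N → p n e ≤ p n d + c
    p-bounded n {d} {e} c d≤D e≤D le = +-cancelˡ-≤ (P n 0) _ _ (begin
      P n 0 + p n e        ≡⟨ P≡p n e≤D ⟨
      P n e                ≤⟨ bounded n c le ⟩
      P n d + c            ≡⟨ cong (_+ c) (P≡p n d≤D) ⟩
      P n 0 + p n d + c    ≡⟨ +-assoc (P n 0) _ _ ⟩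
      P n 0 + (p n d + c)  ∎)
      where open ≤-Reasoning

    X-suc : ∀ d → X (suc (toℕ d)) ≡ X (toℕ d) + workersOn I rounded d
    X-suc d = begin
      X (suc (toℕ d))                                         ≡⟨ hermite N _ ⟨
      sum (λ n → P n (suc (toℕ d)))                           ≡⟨ sum-cong-≗ (λ n → P-suc n d) ⟩
      sum (λ n → P n (toℕ d) + hit ON (rounded n d))          ≡⟨ ∑-distrib-+ (λ n → P n (toℕ d)) _ ⟩
      sum (λ n → P n (toℕ d)) + sum (λ n → hit ON (rounded n d))
        ≡⟨ cong₂ _+_ (hermite N _) (sym (count-hit ON (λ n → rounded n d) id)) ⟩
      X (toℕ d) + workersOn I rounded d                       ∎
      where open ≡-Reasoning

    daysWith≡ : ∀ x n → daysWith I rounded x n ≡ prefix x (rounded n) D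
    daysWith≡ x n = trans (count-hit x (rounded n) id) (sym (prefix-all x (rounded n)))

    d≤D : ∀ {d u} → suc (d + u) ≤ D → d ≤ D
    d≤D {d} {u} le = <⇒≤ (≤-trans (s≤s (m≤m+n d u)) le)

  profile⇒feasible : HasFeasibleSchedule I
  profile⇒feasible = rounded , record
    { staffing    = λ d →
        +-cancelˡ-≤ (X (toℕ d)) _ _ (≤-trans (lower d) (≤-reflexive (X-suc d)))
      , +-cancelˡ-≤ (X (toℕ d)) _ _ (≤-trans (≤-reflexive (sym (X-suc d))) (upper d))
    ; workPeriods = λ n a b period →
        ≤-trans (≤-reflexive (proj₁ upper-only)) (s≤s z≤n)
      , ShortRuns⇒ShortPeriods ON (rounded n)
          (λ d le → p-bounded n uʷ (d≤D le) le (work d le)) a b period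
    ; offPeriods  = λ n a b period →
        ≤-trans (≤-reflexive (proj₂ upper-only)) (s≤s z≤n)
      , ShortRuns⇒ShortPeriods OFF (rounded n)
          (λ d le → complement-≤ (prefix-on+off (rounded n) (d≤D le))
                      (prefix-on+off (rounded n) le)
            (p-grows n 1 (d≤D le) le
              (subst (λ M → X d + M ≤ X (suc (d + uᵒ))) (sym (*-identityˡ N)) (off d le))))
          a b period
    ; totalWork   = λ n → begin
        daysWith I rounded ON n         ≡⟨ daysWith≡ ON n ⟩
        p n D                           ≤⟨ p-bounded n _ z≤n ≤-refl most ⟩
        p n 0 + (D ∸ (D ∸ Uʷ))          ≡⟨ cong (_+ _) (prefix-zero ON (rounded n)) ⟩
        D ∸ (D ∸ Uʷ)                    ≤⟨ cap-≤ D Uʷ ⟩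
        Uʷ                              ∎
    ; totalOff    = λ n → +-cancelˡ-≤ (p n D) _ _ (begin
        p n D + daysWith I rounded OFF n       ≡⟨ cong (p n D +_) (daysWith≡ OFF n) ⟩
        p n D + prefix OFF (rounded n) D       ≡⟨ prefix-on+off (rounded n) ≤-refl ⟩
        D                                      ≤⟨ m≤n+m∸n D Uᵒ ⟩
        Uᵒ + (D ∸ Uᵒ)                          ≤⟨ +-monoʳ-≤ Uᵒ (m≤n+m _ (p n 0)) ⟩
        Uᵒ + (p n 0 + (D ∸ Uᵒ))                ≤⟨ +-monoʳ-≤ Uᵒ (p-grows n _ z≤n ≤-refl least) ⟩
        Uᵒ + p n D                             ≡⟨ +-comm Uᵒ (p n D) ⟩
        p n D + Uᵒ                             ∎)
    }
    where open ≤-Reasoning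

-- Relaxation of difference constraints stored in memory

Memory : Set
Memory = ℕ → ℕ

-- All four fields are addresses; the edge demands
-- m source + m gain ∸ m loss ≤ m target.
record Edge : Set where
  constructor edge
  field
    target source gain loss : ℕ

open Edge

-- Truncation in `bound` is harmless: the unknowns are natural numbers, and `x ∸ l ≤ y` is
-- equivalent to `x ≤ y + l`.
bound gap : Edge → Memory → ℕ
bound e m = m (source e) + m (gain e) ∸ m (loss e)
gap e m = bound e m ∸ m (target e)

-- Adding the gap yields the maximum of the old value and `bound e m`. The gap is kept explicit
-- because the sum of the gaps is the convergence test.
relax : Edge → Memory → Memory
relax e m = m [ target e ↦ m (target e) + gap e m ]

relaxAll : List Edge → Memory → Memory
relaxAll []       m = m
relaxAll (e ∷ es) m = relaxAll es (relax e m)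

increase : List Edge → Memory → ℕ
increase []       m = 0
increase (e ∷ es) m = gap e m + increase es (relax e m)

-- n edges whose targets v and sources u are consecutive addresses; the gain
-- addresses start at a with stride i, the loss addresses at b with stride j.
strip : (n v u a i b j : ℕ) → List Edge
strip zero    v u a i b j = []
strip (suc n) v u a i b j = edge v u a b ∷ strip n (v + 1) (u + 1) (a + i) i (b + j) j

-- Execution of the relaxation code

Straight : Program → Set
Straight (p ⨾ q)       = Straight p × Straight q
Straight (if≢0 _ _ _)  = ⊥
Straight (while≢0 _ _) = ⊥
Straight _             = ⊤

-- Loop-free code is executed by evaluation, so its derivations come from `run-⇓` and only loops
-- need an induction.
run : Program → State → State
run (i ≔ k)         ⟪ r , m ⟫ = ⟪ r [ i ↦ k ] , m ⟫
run (i ≔ j ⊕ k)     ⟪ r , m ⟫ = ⟪ r [ i ↦ r j + r k ] , m ⟫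
run (i ≔ j ⊖ k)     ⟪ r , m ⟫ = ⟪ r [ i ↦ r j ∸ r k ] , m ⟫
run (i ≔mem[ j ])   ⟪ r , m ⟫ = ⟪ r [ i ↦ m (r j) ] , m ⟫
run (mem[ i ]≔ j)   ⟪ r , m ⟫ = ⟪ r , m [ r i ↦ r j ] ⟫
run (p ⨾ q)         s         = run q (run p s)
run skip            s         = s
-- Filler values for control flow, which `Straight` excludes.
run (if≢0 _ _ _)    s         = s
run (while≢0 _ _)   s         = s

steps : Program → ℕ
steps (p ⨾ q) = steps p + steps q
steps _       = 1

run-⇓ : ∀ p {_ : Straight p} {s} → ⟨ p , s ⟩⇓[ steps p ] run p s
run-⇓ (i ≔ k)        = ⇓const
run-⇓ (i ≔ j ⊕ k)    = ⇓add
run-⇓ (i ≔ j ⊖ k)    = ⇓sub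
run-⇓ (i ≔mem[ j ])  = ⇓load
run-⇓ (mem[ i ]≔ j)  = ⇓store
run-⇓ skip           = ⇓skip
run-⇓ (p ⨾ q) {sp , sq} = ⇓seq (run-⇓ p {sp}) (run-⇓ q {sq})

Registers : Set
Registers = ℕ → ℕ

-- Registers below 10 are scratch space.
infix 4 _≈_
_≈_ : Registers → Registers → Set
r ≈ r′ = ∀ i → r′ (10 + i) ≡ r (10 + i)

-- One edge of a strip.  Register 0 sums up the increases, 1 counts the edges
-- that remain; 2 , 3 , 4 , 6 hold the target, source, gain and loss addresses,
-- 5 and 7 the strides.
relaxStep : Program
relaxStep =
  8 ≔mem[ 3 ] ⨾ 9 ≔mem[ 4 ] ⨾ 8 ≔ 8 ⊕ 9 ⨾ 9 ≔mem[ 6 ] ⨾ 8 ≔ 8 ⊖ 9 ⨾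
  9 ≔mem[ 2 ] ⨾ 8 ≔ 8 ⊖ 9 ⨾ 0 ≔ 0 ⊕ 8 ⨾ 9 ≔ 9 ⊕ 8 ⨾ mem[ 2 ]≔ 9 ⨾
  (9 ≔ 1) ⨾ 1 ≔ 1 ⊖ 9 ⨾ 2 ≔ 2 ⊕ 9 ⨾ 3 ≔ 3 ⊕ 9 ⨾ 4 ≔ 4 ⊕ 5 ⨾ 6 ≔ 6 ⊕ 7

relaxStrip : Program
relaxStrip = while≢0 1 relaxStep

-- One round advances the address registers exactly as the recursion of `strip` does, so the
-- induction hypothesis fits by computation. A round costs 16 instructions and a test; the extra
-- step is the exit test.
relaxStrip-⇓ : ∀ n {r m} → r 1 ≡ n →
  let es = strip n (r 2) (r 3) (r 4) (r 5) (r 6) (r 7) in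
  ∃[ r′ ] ⟨ relaxStrip , ⟪ r , m ⟫ ⟩⇓[ 1 + n * 17 ] ⟪ r′ , relaxAll es m ⟫
        × r′ 0 ≡ r 0 + increase es m × r ≈ r′
relaxStrip-⇓ zero    {r} eq = r , ⇓exit eq , sym (+-identityʳ _) , λ _ → refl
relaxStrip-⇓ (suc n) {r} eq
  with r′ , d , acc , same ← relaxStrip-⇓ n (cong (_∸ 1) eq)
  = r′
  , ⇓loop (λ r1≡0 → 0≢1+n (trans (sym r1≡0) eq)) (run-⇓ relaxStep) d
  , trans acc (+-assoc (r 0) _ _)
  , same

copy : Reg → Reg → Program
copy i j = (i ≔ 0) ⨾ i ≔ i ⊕ (11 + j)

-- Apart from the strides, which are literal, a field k stands for the contents
-- of register 11 + k.
record Block : Set where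
  constructor block
  field
    count target source gain gainStride loss lossStride : ℕ

relaxBlock : Block → Program
relaxBlock (block n v u a i b j) = load ⨾ relaxStrip
  where load = copy 1 n ⨾ copy 2 v ⨾ copy 3 u ⨾ copy 4 a ⨾ (5 ≔ i) ⨾ copy 6 b ⨾ (7 ≔ j)

edgesOf : Registers → Block → List Edge
edgesOf r (block n v u a i b j) =
  strip (r (11 + n)) (r (11 + v)) (r (11 + u)) (r (11 + a)) i (r (11 + b)) j

record Relaxes (p : Program) (es : List Edge) (T : ℕ) (r : Registers) (m : Memory) : Set where
  field
    {time}      : ℕ
    {registers} : Registers
    halts       : ⟨ p , ⟪ r , m ⟫ ⟩⇓[ time ] ⟪ registers , relaxAll es m ⟫
    accumulates : registers 0 ≡ r 0 + increase es m
    preserves   : r ≈ registers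
    inTime      : time ≤ T

CountAtMost : ℕ → Registers → Block → Set
CountAtMost D r B = r (11 + Block.count B) ≤ D

-- The 13 consists of 12 instructions that load the registers and the exit test of the loop.
relaxBlock-⇓ : ∀ {D r m} B → CountAtMost D r B →
               Relaxes (relaxBlock B) (edgesOf r B) (13 + D * 17) r m
relaxBlock-⇓ {r = r} (block n v u a i b j) n≤D
  with r′ , d , acc , same ← relaxStrip-⇓ (r (11 + n)) refl = record
  { halts       = ⇓seq (run-⇓ _) d
  ; accumulates = acc
  ; preserves   = same
  ; inTime      = +-monoʳ-≤ 13 (*-monoˡ-≤ 17 n≤D)
  }

relaxAll-++ : ∀ xs ys m → relaxAll (xs ++ ys) m ≡ relaxAll ys (relaxAll xs m)
relaxAll-++ []       ys m = refl
relaxAll-++ (e ∷ xs) ys m = relaxAll-++ xs ys (relax e m)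

increase-++ : ∀ xs ys m →
              increase (xs ++ ys) m ≡ increase xs m + increase ys (relaxAll xs m)
increase-++ []       ys m = refl
increase-++ (e ∷ xs) ys m =
  trans (cong (gap e m +_) (increase-++ xs ys (relax e m))) (sym (+-assoc (gap e m) _ _))

-- Register 10 counts the sweeps that remain.
infix 4 _≋_
_≋_ : Registers → Registers → Set
r ≋ r′ = ∀ i → r′ (11 + i) ≡ r (11 + i)

edgesOf-cong : ∀ r r′ → r ≋ r′ → ∀ B → edgesOf r′ B ≡ edgesOf r B
edgesOf-cong r r′ r≋r′ (block n v u a i b j)
  rewrite r≋r′ n | r≋r′ v | r≋r′ u | r≋r′ a | r≋r′ b = refl

relaxBlocks : List Block → Program
relaxBlocks []       = skip
relaxBlocks (B ∷ Bs) = relaxBlock B ⨾ relaxBlocks Bs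

edgesOfAll : Registers → List Block → List Edge
edgesOfAll r []       = []
edgesOfAll r (B ∷ Bs) = edgesOf r B ++ edgesOfAll r Bs

edgesOfAll-cong : ∀ r r′ → r ≋ r′ → ∀ Bs → edgesOfAll r′ Bs ≡ edgesOfAll r Bs
edgesOfAll-cong r r′ r≋r′ []       = refl
edgesOfAll-cong r r′ r≋r′ (B ∷ Bs) =
  cong₂ _++_ (edgesOf-cong r r′ r≋r′ B) (edgesOfAll-cong r r′ r≋r′ Bs)

CountAtMost-resp : ∀ {D} r r′ → r ≋ r′ → ∀ {Bs} →
                   All (CountAtMost D r) Bs → All (CountAtMost D r′) Bs
CountAtMost-resp {D} r r′ r≋r′ = All.map λ {B} → subst (_≤ D) (sym (r≋r′ (Block.count B)))

relaxes-seq : ∀ {p q xs ys T U r m} → Relaxes p xs T r m →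
              (∀ r′ → r ≈ r′ → Relaxes q ys U r′ (relaxAll xs m)) →
              Relaxes (p ⨾ q) (xs ++ ys) (T + U) r m
relaxes-seq {p} {q} {xs} {ys} {r = r} {m} P Q′ = record
  { halts       = subst (λ m′ → ⟨ p ⨾ q , ⟪ r , m ⟫ ⟩⇓[ _ ] ⟪ _ , m′ ⟫)
                    (sym (relaxAll-++ xs ys m)) (⇓seq P.halts Q.halts)
  ; accumulates = begin
      Q.registers 0
        ≡⟨ Q.accumulates ⟩
      P.registers 0 + increase ys _
        ≡⟨ cong (_+ _) P.accumulates ⟩
      r 0 + increase xs m + increase ys (relaxAll xs m)
        ≡⟨ +-assoc (r 0) _ _ ⟩
      r 0 + (increase xs m + increase ys (relaxAll xs m))
        ≡⟨ cong (r 0 +_) (increase-++ xs ys m) ⟨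
      r 0 + increase (xs ++ ys) m ∎
  ; preserves   = λ i → trans (Q.preserves i) (P.preserves i)
  ; inTime      = +-mono-≤ P.inTime Q.inTime
  }
  where
  open ≡-Reasoning
  module P = Relaxes P
  module Q = Relaxes (Q′ P.registers P.preserves)

blocksTime : ℕ → ℕ → ℕ
blocksTime n D = n * (13 + D * 17) + 1

relaxBlocks-⇓ : ∀ {D} Bs {r m} → All (CountAtMost D r) Bs →
                Relaxes (relaxBlocks Bs) (edgesOfAll r Bs) (blocksTime (length Bs) D) r m
relaxBlocks-⇓ [] [] = record
  { halts       = ⇓skip
  ; accumulates = sym (+-identityʳ _)
  ; preserves   = λ _ → refl
  ; inTime      = ≤-refl
  }
relaxBlocks-⇓ {D} (B ∷ Bs) {r} {m} (n≤D ∷ rest) =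
  subst (λ T → Relaxes (relaxBlocks (B ∷ Bs)) (edgesOfAll r (B ∷ Bs)) T r m)
    (sym (+-assoc (13 + D * 17) _ 1))
    (relaxes-seq (relaxBlock-⇓ {r = r} B n≤D) λ r′ r≈r′ →
      subst (λ es → Relaxes _ es _ r′ _) (edgesOfAll-cong r r′ (r≈r′ ∘ suc) Bs)
        (relaxBlocks-⇓ Bs (CountAtMost-resp r r′ (r≈r′ ∘ suc) rest)))

iterate : List Edge → ℕ → Memory → Memory
iterate es zero    m = m
iterate es (suc k) m = iterate es k (relaxAll es m)

sweep sweeps : List Block → Program
sweep Bs = ((0 ≔ 0) ⨾ relaxBlocks Bs) ⨾ (9 ≔ 1) ⨾ 10 ≔ 10 ⊖ 9
sweeps Bs = while≢0 10 (sweep Bs)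

sweepTime : ℕ → ℕ → ℕ
sweepTime n D = 3 + blocksTime n D

sweep-⇓ : ∀ {D} Bs {r m} → All (CountAtMost D r) Bs →
  ∃[ t ] ∃[ r′ ] ⟨ sweep Bs , ⟪ r , m ⟫ ⟩⇓[ t ] ⟪ r′ , relaxAll (edgesOfAll r Bs) m ⟫
               × r′ 0 ≡ increase (edgesOfAll r Bs) m × r′ 10 ≡ r 10 ∸ 1 × r ≋ r′
               × t ≤ sweepTime (length Bs) D
sweep-⇓ Bs {r} {m} counts =
  _ , _ , ⇓seq (⇓seq ⇓const B.halts) (run-⇓ ((9 ≔ 1) ⨾ 10 ≔ 10 ⊖ 9))
  , B.accumulates
  , cong (_∸ 1) (B.preserves 0) , B.preserves ∘ suc
  , ≤-trans (≤-reflexive (cong suc (+-comm B.time 2))) (+-monoʳ-≤ 3 B.inTime)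
  where
  same : edgesOfAll (r [ 0 ↦ 0 ]) Bs ≡ edgesOfAll r Bs
  same = edgesOfAll-cong r (r [ 0 ↦ 0 ]) (λ _ → refl) Bs

  blocks : Relaxes (relaxBlocks Bs) (edgesOfAll (r [ 0 ↦ 0 ]) Bs) _ (r [ 0 ↦ 0 ]) m
  blocks = relaxBlocks-⇓ Bs (CountAtMost-resp r (r [ 0 ↦ 0 ]) (λ _ → refl) counts)

  module B = Relaxes (subst (λ es → Relaxes (relaxBlocks Bs) es _ (r [ 0 ↦ 0 ]) m) same blocks)

-- Register 0 is cleared at the start of every sweep. What remains is the increase made by the last
-- sweep, started after `k` others: this sweep is the test.
sweeps-⇓ : ∀ {D} k Bs {es r m} → r 10 ≡ suc k →
  edgesOfAll r Bs ≡ es → All (CountAtMost D r) Bs →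
  ∃[ t ] ∃[ r′ ] ⟨ sweeps Bs , ⟪ r , m ⟫ ⟩⇓[ t ] ⟪ r′ , iterate es (suc k) m ⟫
               × r′ 0 ≡ increase es (iterate es k m)
               × t ≤ suc k * (1 + sweepTime (length Bs) D) + 1
sweeps-⇓ {D} k Bs {r = r} {m} eq refl counts
  with t , r₁ , once , acc , counter , r≋r₁ , t≤ ← sweep-⇓ Bs {r} {m} counts
  with k
... | zero   =
    _ , r₁
  , ⇓loop (λ r10≡0 → 0≢1+n (trans (sym r10≡0) eq)) once
      (⇓exit (trans counter (cong (_∸ 1) eq)))
  , acc
  , +-monoˡ-≤ 1 (≤-trans (s≤s t≤) (≤-reflexive (sym (+-identityʳ _))))
... | suc k′
  with u , r₂ , rest , acc′ , u≤ ←
         sweeps-⇓ {D} k′ Bs {r = r₁} {relaxAll (edgesOfAll r Bs) m}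
           (trans counter (cong (_∸ 1) eq))
           (edgesOfAll-cong r r₁ r≋r₁ Bs) (CountAtMost-resp r r₁ r≋r₁ counts)
  = _ , r₂
  , ⇓loop (λ r10≡0 → 0≢1+n (trans (sym r10≡0) eq)) once rest
  , acc′
  , ≤-trans (+-mono-≤ (s≤s t≤) u≤)
      (≤-reflexive (sym (+-assoc (1 + sweepTime (length Bs) D) _ 1)))

-- Convergence of the relaxation

update-same : ∀ m i v → (m [ i ↦ v ]) i ≡ v
update-same m i v rewrite dec-true (i ≟ i) refl = refl

update-other : ∀ m {i} v {x} → x ≢ i → (m [ i ↦ v ]) x ≡ m x
update-other m {i} v {x} x≢i rewrite dec-false (x ≟ i) x≢i = refl

update-elim : ∀ (P : ℕ → ℕ → Set) m i v → P i v → (∀ x → P x (m x)) →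
              ∀ x → P x ((m [ i ↦ v ]) x)
update-elim P m i v new old x with x ≟ i
... | yes refl = subst (P x) (sym (update-same m x v)) new
... | no  x≢i  = subst (P x) (sym (update-other m v x≢i)) (old x)

m+[n∸m]-lub : ∀ {m n o} → m ≤ o → n ≤ o → m + (n ∸ m) ≤ o
m+[n∸m]-lub {m} {n} m≤o n≤o with ≤-total m n
... | inj₁ m≤n = ≤-trans (≤-reflexive (m+[n∸m]≡n m≤n)) n≤o
... | inj₂ n≤m = ≤-trans (≤-reflexive (trans (cong (m +_) (m≤n⇒m∸n≡0 n≤m)) (+-identityʳ m))) m≤o

Satisfies : Memory → Edge → Set
Satisfies m e = bound e m ≤ m (target e)

Solution : List Edge → Memory → Set
Solution es m = All (Satisfies m) es

Satisfies-resp : ∀ {m m′} → m ≗ m′ → ∀ {e} → Satisfies m e → Satisfies m′ e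
Satisfies-resp m≗m′ {edge v u a b} = subst₂ _≤_
  (cong₂ _∸_ (cong₂ _+_ (m≗m′ u) (m≗m′ a)) (m≗m′ b)) (m≗m′ v)

bound-≤ : ∀ {e m m′} → m (source e) ≤ m′ (source e) →
          m (gain e) ≡ m′ (gain e) → m (loss e) ≡ m′ (loss e) → bound e m ≤ bound e m′
bound-≤ {e} {m} {m′} le refl-gain refl-loss
  rewrite refl-gain | refl-loss = ∸-monoˡ-≤ (m′ (loss e)) (+-monoˡ-≤ (m′ (gain e)) le)

relax-satisfied : ∀ e m → gap e m ≡ 0 → m ≗ relax e m
relax-satisfied e m gap≡0 =
  update-elim (λ x v → m x ≡ v) m (target e) _
    (sym (trans (cong (m (target e) +_) gap≡0) (+-identityʳ _))) (λ _ → refl)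

-- As long as the gaps vanish, relaxing leaves the memory pointwise unchanged, so each later edge is
-- in effect tested against `m` itself.
increase≡0⇒Solution : ∀ es m → increase es m ≡ 0 → Solution es m
increase≡0⇒Solution []       m _  = []
increase≡0⇒Solution (e ∷ es) m eq =
  m∸n≡0⇒m≤n gap≡0 ∷ All.map (Satisfies-resp (sym ∘ relax-satisfied e m gap≡0))
                      (increase≡0⇒Solution es (relax e m) (m+n≡0⇒n≡0 (gap e m) eq))
  where gap≡0 = m+n≡0⇒m≡0 (gap e m) eq

Solution⇒increase≡0 : ∀ es m → Solution es m → increase es m ≡ 0
Solution⇒increase≡0 []       m []          = refl
Solution⇒increase≡0 (e ∷ es) m (sat ∷ sol) =
  cong₂ _+_ gap≡0 (Solution⇒increase≡0 es (relax e m)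
                    (All.map (Satisfies-resp (relax-satisfied e m gap≡0)) sol))
  where gap≡0 = m≤n⇒m∸n≡0 sat

module _ (base : ℕ) where

  infix 4 _⊑_
  -- The cells below `base` hold the weights. They must agree exactly, since `bound` decreases when
  -- a loss grows.
  record _⊑_ (m z : Memory) : Set where
    constructor _,_
    field
      below : ∀ x → m x ≤ z x
      fixed : ∀ x → x < base → m x ≡ z x

  open _⊑_

  ⊑-refl : ∀ {m} → m ⊑ m
  ⊑-refl = (λ _ → ≤-refl) , λ _ _ → refl

  ⊑-trans : ∀ {m m′ z} → m ⊑ m′ → m′ ⊑ z → m ⊑ z
  ⊑-trans (p , q) (p′ , q′) =
    (λ x → ≤-trans (p x) (p′ x)) , λ x x<b → trans (q x x<b) (q′ x x<b)

  InRange : ℕ → ℕ → Set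
  InRange K x = base ≤ x × x < base + K

  record WellFormed (K : ℕ) (e : Edge) : Set where
    field
      target-range : InRange K (target e)
      source-range : InRange K (source e)
      gain-fixed   : gain e < base
      loss-fixed   : loss e < base

  open WellFormed

  module _ {K : ℕ} where

    bound-mono : ∀ {m z e} → WellFormed K e → m ⊑ z → bound e m ≤ bound e z
    bound-mono {m} {z} {e} wf (le , eq) =
      bound-≤ {e} {m} {z} (le _) (eq _ (gain-fixed wf)) (eq _ (loss-fixed wf))

    relax-⊒ : ∀ {e} m → WellFormed K e → m ⊑ relax e m
    relax-⊒ {e} m wf .below =
      update-elim (λ x v → m x ≤ v) m (target e) _ (m≤m+n _ _) (λ _ → ≤-refl)
    relax-⊒ {e} m wf .fixed x x<b =
      sym (update-other m _ (λ { refl → <⇒≱ x<b (proj₁ (target-range wf)) }))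

    relax-least : ∀ {e m z} → WellFormed K e → m ⊑ z → Satisfies z e → relax e m ⊑ z
    relax-least {e} {m} {z} wf m⊑z sat .below =
      update-elim (λ x v → v ≤ z x) m (target e) _
        (m+[n∸m]-lub (below m⊑z _) (≤-trans (bound-mono wf m⊑z) sat)) (below m⊑z)
    relax-least {e} {m} wf m⊑z sat .fixed x x<b =
      trans (sym (fixed (relax-⊒ m wf) x x<b)) (fixed m⊑z x x<b)

    relaxAll-⊒ : ∀ {es} m → All (WellFormed K) es → m ⊑ relaxAll es m
    relaxAll-⊒ m []         = ⊑-refl
    relaxAll-⊒ m (wf ∷ wfs) = ⊑-trans (relax-⊒ m wf) (relaxAll-⊒ _ wfs)

    relaxAll-least : ∀ {es m z} → All (WellFormed K) es → m ⊑ z → Solution es z →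
                     relaxAll es m ⊑ z
    relaxAll-least []         m⊑z []          = m⊑z
    relaxAll-least (wf ∷ wfs) m⊑z (sat ∷ sol) =
      relaxAll-least wfs (relax-least wf m⊑z sat) sol

    relax-reaches : ∀ e m → bound e m ≤ relax e m (target e)
    relax-reaches e m rewrite update-same m (target e) (m (target e) + gap e m) =
      m≤n+m∸n (bound e m) (m (target e))

    -- A sweep works in place, but updates only raise values; at its end every target has reached at
    -- least the bound computed from the memory before the sweep.
    relaxAll-reaches : ∀ {es m₀ m} → All (WellFormed K) es → m₀ ⊑ m →
                       All (λ e → bound e m₀ ≤ relaxAll es m (target e)) es
    relaxAll-reaches []                       m₀⊑m = []
    relaxAll-reaches {e ∷ es} {m = m} (wf ∷ wfs) m₀⊑m =
        ≤-trans (bound-mono wf m₀⊑m)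
          (≤-trans (relax-reaches e m) (below (relaxAll-⊒ (relax e m) wfs) (target e)))
      ∷ relaxAll-reaches wfs (⊑-trans m₀⊑m (relax-⊒ m wf))

    iterate-⊒ : ∀ {es} k m → All (WellFormed K) es → m ⊑ iterate es k m
    iterate-⊒ zero    m wfs = ⊑-refl
    iterate-⊒ (suc k) m wfs = ⊑-trans (relaxAll-⊒ m wfs) (iterate-⊒ k _ wfs)

    sumOver : (ℕ → ℕ) → ℕ
    sumOver g = sum {K} (λ j → g (base + toℕ j))

    sumOver-squeeze : ∀ {g h} → (∀ x → g x ≤ h x) → sumOver h ≤ sumOver g →
                      ∀ {x} → InRange K x → h x ≤ g x
    sumOver-squeeze {g} {h} g≤h le {x} (b≤x , x<b+K) =
      subst (λ x → h x ≤ g x) x≡ (sum-squeeze (λ _ → g≤h _) le (fromℕ< x∸b<K))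
      where
      x∸b<K : x ∸ base < K
      x∸b<K = subst (x ∸ base <_) (m+n∸m≡n base K) (∸-monoˡ-< x<b+K b≤x)
      x≡ : base + toℕ (fromℕ< x∸b<K) ≡ x
      x≡ = trans (cong (base +_) (toℕ-fromℕ< x∸b<K)) (m+[n∸m]≡n b≤x)

    -- The indicator of `m x < z x`, so that `unsettled` counts the unknowns still below `z`.
    lag : Memory → Memory → ℕ → ℕ
    lag m z x = 1 ⊓ (z x ∸ m x)

    unsettled : Memory → Memory → ℕ
    unsettled m z = sumOver (lag m z)

    unsettled-mono : ∀ {m m′ z z′} → m′ ⊑ m → z ⊑ z′ → unsettled m z ≤ unsettled m′ z′
    unsettled-mono m′⊑m z⊑z′ =
      sum-mono-≤ {K} λ _ → ⊓-monoʳ-≤ 1 (∸-mono (below z⊑z′ _) (below m′⊑m _))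

    unsettled-≤ : ∀ m z → unsettled m z ≤ K
    unsettled-≤ m z = begin
      unsettled m z       ≤⟨ sum-mono-≤ {K} (λ j → m⊓n≤m 1 (z (base + toℕ j) ∸ m (base + toℕ j))) ⟩
      sum {K} (λ _ → 1)   ≡⟨ sum-const K 1 ⟩
      K * 1               ≡⟨ *-identityʳ K ⟩
      K                   ∎
      where open ≤-Reasoning

    lag≤0⇒settled : ∀ m z {x} → lag m z x ≤ 0 → z x ≤ m x
    lag≤0⇒settled m z {x} le with z x ∸ m x in eq
    ... | zero = m∸n≡0⇒m≤n eq
    lag≤0⇒settled m z () | suc _

    unsettled≤0⇒Solution : ∀ {es m z} → All (WellFormed K) es → m ⊑ z → Solution es z →
                           unsettled m z ≤ 0 → Solution es m
    unsettled≤0⇒Solution {es} {m} {z} wfs m⊑z sol le = All.zipWith satisfied (wfs , sol)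
      where
      settled : ∀ {x} → InRange K x → z x ≤ m x
      settled = lag≤0⇒settled m z ∘ sumOver-squeeze {λ _ → 0} {lag m z} (λ _ → z≤n) (≤-trans le z≤n)
      satisfied : ∀ {e} → WellFormed K e × Satisfies z e → Satisfies m e
      satisfied (wf , sat) =
        ≤-trans (bound-mono wf m⊑z) (≤-trans sat (settled (target-range wf)))

    -- For `m ⊑ z` this is `z x ∸ 1` where `m x < z x`, and `z x` where the two agree.
    lowered : Memory → Memory → Memory
    lowered m z x = m x ⊔ (z x ∸ 1)

    ⊑-lowered : ∀ {m z} → m ⊑ z → m ⊑ lowered m z
    ⊑-lowered m⊑z .below x     = m≤m⊔n _ _
    ⊑-lowered m⊑z .fixed x x<b =
      sym (m≥n⇒m⊔n≡m (≤-trans (m∸n≤m _ 1) (≤-reflexive (sym (fixed m⊑z x x<b)))))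

    lowered-⊑ : ∀ {m z} → m ⊑ z → lowered m z ⊑ z
    lowered-⊑ m⊑z .below x     = ⊔-lub (below m⊑z x) (m∸n≤m _ 1)
    lowered-⊑ m⊑z .fixed x x<b = trans (sym (fixed (⊑-lowered m⊑z) x x<b)) (fixed m⊑z x x<b)

    lag-positive : ∀ m z {x} → m x < z x → 1 ≤ lag m z x
    lag-positive m z m<z = ⊓-glb ≤-refl (m<n⇒0<n∸m m<z)

    lag-positive⁻¹ : ∀ m z {x} → 1 ≤ lag m z x → m x < z x
    lag-positive⁻¹ m z {x} 1≤lag = ≰⇒> λ z≤m →
      <⇒≱ 1≤lag (≤-reflexive (cong (1 ⊓_) (m≤n⇒m∸n≡0 z≤m)))

    -- A settled target keeps its value while the bound can only drop. If target and source are both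
    -- unsettled, both drop by one. If only the target is unsettled, the sweep has lifted it to the
    -- bound and, being stuck, left it strictly below `z`, so there is slack of one.
    lowered-Solution : ∀ {es m z} → All (WellFormed K) es → m ⊑ z → Solution es z →
                     unsettled m z ≤ unsettled (relaxAll es m) z → Solution es (lowered m z)
    lowered-Solution {es} {m} {z} wfs m⊑z sol stuck =
      All.zipWith satisfied (wfs , All.zip (sol , relaxAll-reaches wfs ⊑-refl))
      where
      m′ z′ : Memory
      m′ = relaxAll es m
      z′ = lowered m z

      still-unsettled : ∀ {x} → InRange K x → m x < z x → m′ x < z x
      still-unsettled {x} rx m<z = lag-positive⁻¹ m′ z
        (≤-trans (lag-positive m z m<z)
          (sumOver-squeeze
            (λ x → ⊓-monoʳ-≤ 1 (∸-monoʳ-≤ (z x) (below (relaxAll-⊒ m wfs) x))) stuck rx))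

      satisfied : ∀ {e} → WellFormed K e × Satisfies z e × bound e m ≤ m′ (target e) →
                  Satisfies z′ e
      satisfied {e} (wf , sat , reach) with m (target e) <? z (target e)
      ... | no m≮z = ≤-trans (bound-mono wf (lowered-⊑ m⊑z))
                       (≤-trans sat (≤-trans (≮⇒≥ m≮z) (m≤m⊔n _ _)))
      ... | yes m<z with m (source e) <? z (source e)
      ...   | no  m≮z = begin
        bound e z′        ≤⟨ bound-≤ {e} {z′} {m} (⊔-lub ≤-refl (≤-trans (m∸n≤m _ 1) (≮⇒≥ m≮z)))
                               (sym (fixed (⊑-lowered m⊑z) _ (gain-fixed wf)))
                               (sym (fixed (⊑-lowered m⊑z) _ (loss-fixed wf))) ⟩
        bound e m         ≤⟨ reach ⟩
        m′ (target e)     ≤⟨ pred-mono-≤ (still-unsettled (target-range wf) m<z) ⟩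
        z (target e) ∸ 1  ≤⟨ m≤n⊔m (m (target e)) _ ⟩
        z′ (target e)     ∎
        where open ≤-Reasoning
      ...   | yes m<z-source = begin
        z′ (source e) + z′ (gain e) ∸ z′ (loss e)
          ≡⟨ cong₂ (λ g l → z′ (source e) + g ∸ l) (fixed (lowered-⊑ m⊑z) _ (gain-fixed wf))
                                                   (fixed (lowered-⊑ m⊑z) _ (loss-fixed wf)) ⟩
        z′ (source e) + z (gain e) ∸ z (loss e)
          ≡⟨ cong (λ u → u + z (gain e) ∸ z (loss e)) (m≤n⇒m⊔n≡n (pred-mono-≤ m<z-source)) ⟩
        z (source e) ∸ 1 + z (gain e) ∸ z (loss e)
          ≤⟨ pred-source {g = z (gain e)} {z (loss e)} (≤-<-trans z≤n m<z-source) sat ⟩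
        z (target e) ∸ 1
          ≤⟨ m≤n⊔m (m (target e)) _ ⟩
        z′ (target e) ∎
        where
        open ≤-Reasoning
        pred-source : ∀ {u g l t} → 0 < u → u + g ∸ l ≤ t → u ∸ 1 + g ∸ l ≤ t ∸ 1
        pred-source {suc u} {g} {l} _ le = ≤-trans (≤-reflexive eq) (∸-monoˡ-≤ 1 le)
          where
          eq : u + g ∸ l ≡ suc (u + g) ∸ l ∸ 1
          eq = sym (trans (∸-+-assoc (suc (u + g)) l 1) (cong (suc (u + g) ∸_) (+-comm l 1)))

    -- If a sweep settles no further vertex, lowering z by one on the
    -- unsettled vertices gives a smaller solution above m.
    converge : ∀ {es} k {m z} → All (WellFormed K) es → m ⊑ z → Solution es z →
               unsettled m z ≤ k → Solution es (iterate es k m)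
    converge zero            wfs m⊑z sol le = unsettled≤0⇒Solution wfs m⊑z sol le
    converge {es} (suc k) {m} wfs m⊑z sol le = descend _ m⊑z sol le ≤-refl
      where
      -- The conclusion does not mention `z`, so `z` may be replaced. The fuel `s` bounds its total,
      -- which drops strictly: otherwise nothing would be unsettled, against `≰k`.
      descend : ∀ s {z} → m ⊑ z → Solution es z → unsettled m z ≤ suc k → sumOver z < s →
                Solution es (iterate es (suc k) m)
      descend (suc s) {z} m⊑z sol le size<s with unsettled (relaxAll es m) z ≤? k
      ... | yes le′ = converge k wfs (relaxAll-least wfs m⊑z sol) sol le′
      ... | no  ≰k  = descend s (⊑-lowered m⊑z) (lowered-Solution wfs m⊑z sol stuck)
                        (≤-trans (unsettled-mono {m} {m} ⊑-refl (lowered-⊑ m⊑z)) le)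
                        (<-≤-trans (≰⇒> no-drop) (s≤s⁻¹ size<s))
        where
        stuck : unsettled m z ≤ unsettled (relaxAll es m) z
        stuck = ≤-trans le (≰⇒> ≰k)

        no-drop : ¬ (sumOver z ≤ sumOver (lowered m z))
        no-drop size≤ = ≰k (begin
          unsettled (relaxAll es m) z
            ≤⟨ unsettled-mono {relaxAll es m} {m} {z} (relaxAll-⊒ m wfs) ⊑-refl ⟩
          unsettled m z
            ≡⟨ sum-cong-≗ {K} (λ j → lag≡0 (base + toℕ j)
                                       (m≤m+n base _ , +-monoʳ-< base (toℕ<n j))) ⟩
          sum {K} (λ _ → 0)
            ≡⟨ sum-replicate-zero K ⟩
          0
            ≤⟨ z≤n ⟩
          k ∎)
          where
          open ≤-Reasoning
          lag≡0 : ∀ x → InRange K x → lag m z x ≡ 0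
          lag≡0 x rx = cong (1 ⊓_) (m≤n⇒m∸n≡0 {z x} {m x} (≮⇒≥ λ m<z →
            <⇒≱ (⊔-pres-<m m<z (∸-monoʳ-< {z x} {1} {0} ≤-refl (≤-<-trans z≤n m<z)))
                (sumOver-squeeze (below (lowered-⊑ m⊑z)) size≤ rx)))

    settles : ∀ {es m z} → All (WellFormed K) es → m ⊑ z → Solution es z →
              Solution es (iterate es K m)
    settles {m = m} {z} wfs m⊑z sol = converge K wfs m⊑z sol (unsettled-≤ m z)

-- The random access program

-- Multiplication by repeated addition. The cost depends on the multiplier in register 1 alone, so
-- `N` is always taken as the summand in register 3.
accumulate : Program
accumulate = while≢0 1 (2 ≔ 2 ⊕ 3 ⨾ (4 ≔ 1) ⨾ 1 ≔ 1 ⊖ 4)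

accumulate-⇓ : ∀ n {r m} → r 1 ≡ n →
  ∃[ r′ ] ⟨ accumulate , ⟪ r , m ⟫ ⟩⇓[ 1 + n * 4 ] ⟪ r′ , m ⟫
        × r′ 2 ≡ r 2 + n * r 3 × r ≈ r′
accumulate-⇓ zero    {r} eq = r , ⇓exit eq , sym (+-identityʳ _) , λ _ → refl
accumulate-⇓ (suc n) {r} eq
  with r′ , d , sum , same ← accumulate-⇓ n (cong (_∸ 1) eq)
  = r′
  , ⇓loop (λ r1≡0 → 0≢1+n (trans (sym r1≡0) eq)) (run-⇓ (2 ≔ 2 ⊕ 3 ⨾ (4 ≔ 1) ⨾ 1 ≔ 1 ⊖ 4)) d
  , trans sum (+-assoc (r 2) _ _)
  , same

storeMultiple : (address multiplier multiplicand : ℕ) → Program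
storeMultiple a k n =
  (copy 1 k ⨾ (2 ≔ 0) ⨾ copy 3 n) ⨾ accumulate ⨾ (4 ≔ a) ⨾ mem[ 4 ]≔ 2

storeMultiple-⇓ : ∀ a k n {x y r m} → r (11 + k) ≡ x → r (11 + n) ≡ y →
  ∃[ r′ ] ⟨ storeMultiple a k n , ⟪ r , m ⟫ ⟩⇓[ 6 + x * 4 + 2 ] ⟪ r′ , m [ a ↦ x * y ] ⟫
        × r ≈ r′
storeMultiple-⇓ a k n {r = r} {m} refl refl
  with r′ , d , eq , same ←
         accumulate-⇓ (r (11 + k))
           {State.reg (run (copy 1 k ⨾ (2 ≔ 0) ⨾ copy 3 n) ⟪ r , m ⟫)} {m} refl
  = r′ [ 4 ↦ a ]
  , subst (λ v → ⟨ storeMultiple a k n , ⟪ r , m ⟫ ⟩⇓[ 6 + r (11 + k) * 4 + 2 ]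
                   ⟪ r′ [ 4 ↦ a ] , m [ a ↦ v ] ⟫) eq
      (⇓seq (run-⇓ (copy 1 k ⨾ (2 ≔ 0) ⨾ copy 3 n)) (⇓seq d (run-⇓ ((4 ≔ a) ⨾ mem[ 4 ]≔ 2))))
  , same

-- Afterwards 10 holds D + 2, the number of sweeps, and 11 … 29 hold
--   D , B , B+1 , B+1+uᵒ , D∸uᵒ , B+1+uʷ , D∸uʷ , B+D , 8 , 8+D ,
--   1 , 2 , 3 , 6 , 7 , N , min(D,uʷ) , min(D,Uʷ) , D∸Uᵒ
-- where X d will live at address B + d, just after the input.  Cell 2 (lʷ) is
-- overwritten by the constant 0.
prologue : Program
prologue =
  (1 ≔ 0) ⨾ 11 ≔mem[ 1 ] ⨾ (21 ≔ 1) ⨾ 26 ≔mem[ 21 ] ⨾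
  (22 ≔ 2) ⨾ (23 ≔ 3) ⨾ (24 ≔ 6) ⨾ (25 ≔ 7) ⨾ (19 ≔ 8) ⨾
  20 ≔ 19 ⊕ 11 ⨾ 12 ≔ 20 ⊕ 11 ⨾ 13 ≔ 12 ⊕ 21 ⨾ 18 ≔ 12 ⊕ 11 ⨾
  (2 ≔ 5) ⨾ 2 ≔mem[ 2 ] ⨾ 14 ≔ 13 ⊕ 2 ⨾ 15 ≔ 11 ⊖ 2 ⨾
  2 ≔mem[ 23 ] ⨾ 16 ≔ 13 ⊕ 2 ⨾ 17 ≔ 11 ⊖ 2 ⨾ 27 ≔ 11 ⊖ 17 ⨾
  2 ≔mem[ 24 ] ⨾ 2 ≔ 11 ⊖ 2 ⨾ 28 ≔ 11 ⊖ 2 ⨾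
  2 ≔mem[ 25 ] ⨾ 29 ≔ 11 ⊖ 2 ⨾
  10 ≔ 11 ⊕ 22 ⨾ mem[ 22 ]≔ 1

-- In the order of the fields of Profile.
blocks : List Block
blocks = block 0 2 1 8 1 11 0
       ∷ block 0 1 2 11 0 9 1
       ∷ block 4 3 1 10 0 11 0
       ∷ block 6 1 5 11 0 12 0
       ∷ block 10 7 1 14 0 11 0
       ∷ block 10 1 7 11 0 13 0
       ∷ []

-- The final truncated subtraction from 1 turns the last increase into the verdict: 1 if it is zero,
-- 0 otherwise.
solve decide : Program
solve = storeMultiple 3 16 15 ⨾ storeMultiple 6 17 15 ⨾ storeMultiple 7 18 15
      ⨾ sweeps blocks ⨾ (1 ≔ 1) ⨾ 0 ≔ 1 ⊖ 0
decide = prologue ⨾ solve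

solveTime : ℕ → ℕ → ℕ
solveTime k D = c + (c + (c + (suc k * (1 + sweepTime 6 D) + 1 + 2)))
  where c = 6 + D * 4 + 2

solve-⇓ : ∀ k {D es r m} → r 10 ≡ suc k → edgesOfAll r blocks ≡ es →
  All (CountAtMost D r) blocks → r 27 ≤ D → r 28 ≤ D → r 29 ≤ D →
  let m′ = m [ 3 ↦ r 27 * r 26 ] [ 6 ↦ r 28 * r 26 ] [ 7 ↦ r 29 * r 26 ] in
  ∃[ t ] ∃[ s ] ⟨ solve , ⟪ r , m ⟫ ⟩⇓[ t ] s
              × State.reg s 0 ≡ 1 ∸ increase es (iterate es k m′)
              × t ≤ solveTime k D
solve-⇓ k {D} {es} {r} {m} eq refl counts b₁ b₂ b₃
  with r₁ , d₁ , r≈r₁ ← storeMultiple-⇓ 3 16 15 {r = r} {m} refl refl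
  with r₂ , d₂ , r₁≈r₂ ←
         storeMultiple-⇓ 6 17 15 {r = r₁} {m [ 3 ↦ r 27 * r 26 ]} (r≈r₁ 18) (r≈r₁ 16)
  with r₃ , d₃ , r₂≈r₃ ←
         storeMultiple-⇓ 7 18 15 {r = r₂} {m [ 3 ↦ r 27 * r 26 ] [ 6 ↦ r 28 * r 26 ]}
           (trans (r₁≈r₂ 19) (r≈r₁ 19)) (trans (r₁≈r₂ 16) (r≈r₁ 16))
  with r≋r₃ ← (λ i → trans (r₂≈r₃ (1 + i)) (trans (r₁≈r₂ (1 + i)) (r≈r₁ (1 + i))))
  with t , r₄ , d₄ , acc , t≤ ← sweeps-⇓ {D} k blocks {r = r₃}
         {m [ 3 ↦ r 27 * r 26 ] [ 6 ↦ r 28 * r 26 ] [ 7 ↦ r 29 * r 26 ]}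
         (trans (r₂≈r₃ 0) (trans (r₁≈r₂ 0) (trans (r≈r₁ 0) eq)))
         (edgesOfAll-cong r r₃ r≋r₃ blocks) (CountAtMost-resp r r₃ r≋r₃ counts)
  = _ , _
  , ⇓seq d₁ (⇓seq d₂ (⇓seq d₃ (⇓seq d₄ (run-⇓ ((1 ≔ 1) ⨾ 0 ≔ 1 ⊖ 0)))))
  , cong (1 ∸_) acc
  , +-mono-≤ (cost b₁) (+-mono-≤ (cost b₂) (+-mono-≤ (cost b₃) (+-monoˡ-≤ 2 t≤)))
  where
  cost : ∀ {x} → x ≤ D → 6 + x * 4 + 2 ≤ 6 + D * 4 + 2
  cost x≤D = +-monoˡ-≤ 2 (+-monoʳ-≤ 6 (*-monoˡ-≤ 4 x≤D))

totalTime : ℕ → ℕ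
totalTime D = steps prologue + solveTime (suc D) D

totalTime-quadratic : ∀ {D} → 1 ≤ D → totalTime D ≤ 640 * D ^ 2
totalTime-quadratic {suc d} _ = ≤-trans (m≤m+n _ _) (≤-reflexive (eq d))
  where
  eq : ∀ d → let c = 6 + (1 + d) * 4 + 2 in
       28 + (c + (c + (c + ((3 + d) * (4 + (6 * (13 + (1 + d) * 17) + 1)) + 1 + 2))))
         -- The slack below 640. The quadratic coefficient of the running time is only 102, but at
         -- `D = 1` the bound is already 622.
         + (538 * d * d + 777 * d + 18)
       ≡ 640 * ((1 + d) * ((1 + d) * 1))
  eq = solve-∀

prepend : ∀ {p q s₀ s₁ a t₁ T U} →
  ⟨ p , s₀ ⟩⇓[ t₁ ] s₁ → (∃[ t ] ∃[ s ] ⟨ q , s₁ ⟩⇓[ t ] s × State.reg s 0 ≡ a × t ≤ T) →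
  t₁ + T ≤ U → ∃[ t ] ∃[ s ] ⟨ p ⨾ q , s₀ ⟩⇓[ t ] s × State.reg s 0 ≡ a × t ≤ U
prepend {t₁ = t₁} d (t , s , e , answer , t≤) le =
  t₁ + t , s , ⇓seq d e , answer , ≤-trans (+-monoʳ-≤ t₁ t≤) le

module _ (I : DODOSP) where
  open DODOSP I

  base : ℕ
  base = 8 + D + D

  -- Written with the association and the final `[]` that result from evaluating `blocks` in the
  -- registers set by the prologue, so that the two lists agree by `refl`.
  edges : List Edge
  edges = strip D (base + 1) base 8 1 2 0
       ++ strip D base (base + 1) 2 0 (8 + D) 1
       ++ strip (D ∸ uᵒ) (base + 1 + uᵒ) base 1 0 2 0
       ++ strip (D ∸ uʷ) base (base + 1 + uʷ) 2 0 3 0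
       ++ strip 1 (base + D) base 7 0 2 0
       ++ strip 1 base (base + D) 2 0 6 0
       ++ []

  table : Memory
  table = cells (encode I) [ 2 ↦ 0 ] [ 3 ↦ (D ∸ (D ∸ uʷ)) * N ]
          [ 6 ↦ (D ∸ (D ∸ Uʷ)) * N ] [ 7 ↦ (D ∸ Uᵒ) * N ]

  private
    s₀ : State
    s₀ = run prologue (initial (encode I))

    counts : All (CountAtMost D (State.reg s₀)) blocks
    counts = ≤-refl ∷ ≤-refl ∷ m∸n≤m D uᵒ ∷ m∸n≤m D uʷ ∷ 1≤D ∷ 1≤D ∷ []

    solved : ∃[ t ] ∃[ s ] ⟨ solve , ⟪ State.reg s₀ , State.mem s₀ ⟫ ⟩⇓[ t ] s
           × State.reg s 0 ≡ 1 ∸ increase edges (iterate edges (suc D) table)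
           × t ≤ solveTime (suc D) D
    solved = solve-⇓ (suc D) {D} {edges} {State.reg s₀} {State.mem s₀} (+-comm D 2) refl
      counts
      (m∸n≤m D (D ∸ uʷ)) (m∸n≤m D (D ∸ Uʷ)) (m∸n≤m D Uᵒ)

    prologue-⇓ : ⟨ prologue , initial (encode I) ⟩⇓[ 28 ] s₀
    prologue-⇓ = run-⇓ prologue {_} {initial (encode I)}

  decide-⇓ : ∃[ t ] ∃[ s ] ⟨ decide , initial (encode I) ⟩⇓[ t ] s
           × State.reg s 0 ≡ 1 ∸ increase edges (iterate edges (suc D) table)
           × t ≤ 640 * D ^ 2
  decide-⇓ = prepend {prologue} {solve} {initial (encode I)} {s₀}
    {1 ∸ increase edges (iterate edges (suc D) table)}
    {28} {solveTime (suc D) D} {640 * D ^ 2}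
    prologue-⇓ solved (totalTime-quadratic {D} 1≤D)

-- Correctness of the program

-- The closed form of the edge at position `k` of a strip, whose own addresses advance by repeated
-- addition as on the machine.
member : (v u a i b j k : ℕ) → Edge
member v u a i b j k = edge (v + k) (u + k) (a + k * i) (b + k * j)

member-zero : ∀ v u a i b j → member v u a i b j 0 ≡ edge v u a b
member-zero v u a i b j
  rewrite +-identityʳ v | +-identityʳ u | +-identityʳ a | +-identityʳ b = refl

member-suc : ∀ v u a i b j k →
             member (v + 1) (u + 1) (a + i) i (b + j) j k ≡ member v u a i b j (suc k)
member-suc v u a i b j k
  rewrite +-assoc v 1 k | +-assoc u 1 k | +-assoc a i (k * i) | +-assoc b j (k * j) = refl

module _ {P : Edge → Set} {i j : ℕ} where

  strip⁺ : ∀ n {v u a b} → (∀ (k : Fin n) → P (member v u a i b j (toℕ k))) →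
           All P (strip n v u a i b j)
  strip⁺ zero    f = []
  strip⁺ (suc n) {v} {u} {a} {b} f =
      subst P (member-zero v u a i b j) (f zero)
    ∷ strip⁺ n (λ k → subst P (sym (member-suc v u a i b j (toℕ k))) (f (suc k)))

  strip⁻ : ∀ n {v u a b} → All P (strip n v u a i b j) →
           ∀ (k : Fin n) → P (member v u a i b j (toℕ k))
  strip⁻ (suc n) {v} {u} {a} {b} (p ∷ ps) zero    = subst P (sym (member-zero v u a i b j)) p
  strip⁻ (suc n) {v} {u} {a} {b} (p ∷ ps) (suc k) =
    subst P (member-suc v u a i b j (toℕ k)) (strip⁻ n ps k)

cells-tabulate : ∀ {n} (g : Fin n → ℕ) ys i → cells (List.tabulate g ++ ys) (toℕ i) ≡ g i
cells-tabulate g ys zero    = refl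
cells-tabulate g ys (suc i) = cells-tabulate (g ∘ suc) ys i

cells-++ : ∀ xs {ys} i → cells (xs ++ ys) (length xs + i) ≡ cells ys i
cells-++ []       i = refl
cells-++ (x ∷ xs) i = cells-++ xs i

cells-[] : ∀ xs i → cells xs (length xs + i) ≡ 0
cells-[] []       i = refl
cells-[] (x ∷ xs) i = cells-[] xs i

lossy⁺ : ∀ {x y} c → x ≤ y + c → x + 0 ∸ c ≤ y
lossy⁺ {x} {y} c le = m≤n+o⇒m∸n≤o (x + 0) c
  (≤-trans (≤-reflexive (+-identityʳ x)) (≤-trans le (≤-reflexive (+-comm y c))))

lossy⁻ : ∀ {x y} c → x + 0 ∸ c ≤ y → x ≤ y + c
lossy⁻ {x} {y} c le rewrite +-identityʳ x =
  ≤-trans (m≤n+m∸n x c) (≤-trans (+-monoʳ-≤ c le) (≤-reflexive (+-comm c y)))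

module _ (I : DODOSP) where
  open DODOSP I

  private
    b₀ = base I
    m₀ = table I
    requirements = List.tabulate rˡ ++ List.tabulate rᵘ

  table-lower : ∀ d → m₀ (8 + toℕ d) ≡ rˡ d
  table-lower d = cells-tabulate rˡ _ d

  table-upper : ∀ d → m₀ (8 + D + toℕ d) ≡ rᵘ d
  table-upper d = begin
    cells requirements (D + toℕ d)
      ≡⟨ cong (λ n → cells requirements (n + toℕ d)) (length-tabulate rˡ) ⟨
    cells requirements (length (List.tabulate rˡ) + toℕ d)
      ≡⟨ cells-++ (List.tabulate rˡ) (toℕ d) ⟩
    cells (List.tabulate rᵘ) (toℕ d)
      ≡⟨ cong (λ xs → cells xs (toℕ d)) (++-identityʳ (List.tabulate rᵘ)) ⟨
    cells (List.tabulate rᵘ ++ []) (toℕ d)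
      ≡⟨ cells-tabulate rᵘ [] d ⟩
    rᵘ d ∎
    where open ≡-Reasoning

  -- Cells beyond the input hold 0, so the unknowns start at the least assignment, below every
  -- solution.
  table-zero : ∀ d → m₀ (b₀ + d) ≡ 0
  table-zero d =
    trans (cong (λ n → cells requirements (n + d)) (sym length≡)) (cells-[] requirements d)
    where
    length≡ : length requirements ≡ D + D
    length≡ = trans (length-++ (List.tabulate rˡ))
                (cong₂ _+_ (length-tabulate rˡ) (length-tabulate rᵘ))

  -- With X d stored at address b₀ + d, the edge e says X s + g ∸ l ≤ X t.
  record Encodes (e : Edge) (t s g l : ℕ) : Set where
    field
      target≡ : target e ≡ b₀ + t
      source≡ : source e ≡ b₀ + s
      target≤ : t ≤ D
      source≤ : s ≤ D
      gain<   : gain e < b₀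
      gain≡   : m₀ (gain e) ≡ g
      loss<   : loss e < b₀
      loss≡   : m₀ (loss e) ≡ l

  open Encodes

  encodes⇒wellFormed : ∀ {e t s g l} → Encodes e t s g l → WellFormed b₀ (suc D) e
  encodes⇒wellFormed enc = record
    { target-range = range (target≡ enc) (target≤ enc)
    ; source-range = range (source≡ enc) (source≤ enc)
    ; gain-fixed   = gain< enc
    ; loss-fixed   = loss< enc
    }
    where
    range : ∀ {x d} → x ≡ b₀ + d → d ≤ D → InRange b₀ (suc D) x
    range refl d≤D = m≤m+n b₀ _ , +-monoʳ-< b₀ (s≤s d≤D)

  fixed-address : ∀ a k → a + k * 0 ≡ a
  fixed-address a k = trans (cong (a +_) (*-zeroʳ k)) (+-identityʳ a)

  header< : ∀ {a} k → a < 8 → a + k * 0 < b₀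
  header< {a} k a<8 = subst (_< b₀) (sym (fixed-address a k)) (≤-trans a<8 (m≤m+n 8 (D + D)))

  encodes-lower : ∀ (k : Fin D) →
    Encodes (member (b₀ + 1) b₀ 8 1 2 0 (toℕ k)) (suc (toℕ k)) (toℕ k) (rˡ k) 0
  encodes-lower k = record
    { target≡ = +-assoc b₀ 1 _
    ; source≡ = refl
    ; target≤ = toℕ<n k
    ; source≤ = toℕ≤n k
    ; gain<   = subst (λ i → 8 + i < b₀) (sym (*-identityʳ (toℕ k)))
                  (+-monoʳ-< 8 (≤-trans (toℕ<n k) (m≤m+n D D)))
    ; gain≡   = trans (cong (λ i → m₀ (8 + i)) (*-identityʳ (toℕ k))) (table-lower k)
    ; loss<   = header< (toℕ k) (m≤m+n 3 5)
    ; loss≡   = cong m₀ (fixed-address 2 (toℕ k))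
    }

  encodes-upper : ∀ (k : Fin D) →
    Encodes (member b₀ (b₀ + 1) 2 0 (8 + D) 1 (toℕ k)) (toℕ k) (suc (toℕ k)) 0 (rᵘ k)
  encodes-upper k = record
    { target≡ = refl
    ; source≡ = +-assoc b₀ 1 _
    ; target≤ = toℕ≤n k
    ; source≤ = toℕ<n k
    ; gain<   = header< (toℕ k) (m≤m+n 3 5)
    ; gain≡   = cong m₀ (fixed-address 2 (toℕ k))
    ; loss<   = subst (λ i → 8 + D + i < b₀) (sym (*-identityʳ (toℕ k)))
                  (+-monoʳ-< (8 + D) (toℕ<n k))
    ; loss≡   = trans (cong (λ i → m₀ (8 + D + i)) (*-identityʳ (toℕ k))) (table-upper k)
    }

  window : ∀ u k → b₀ + 1 + u + k ≡ b₀ + suc (k + u)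
  window u k = trans (+-assoc (b₀ + 1) u k)
    (trans (+-assoc b₀ 1 (u + k)) (cong (λ w → b₀ + suc w) (+-comm u k)))

  window≤ : ∀ {u k} → k < D ∸ u → suc (k + u) ≤ D
  window≤ {u} {k} k< =
    m≤o∸n⇒m+n≤o (suc k) (<⇒≤ (m∸n≢0⇒n<m (λ D∸u≡0 → n≮0 (subst (k <_) D∸u≡0 k<)))) k<

  encodes-off : ∀ k → k < D ∸ uᵒ →
    Encodes (member (b₀ + 1 + uᵒ) b₀ 1 0 2 0 k) (suc (k + uᵒ)) k N 0
  encodes-off k k< = record
    { target≡ = window uᵒ k
    ; source≡ = refl
    ; target≤ = window≤ k<
    ; source≤ = ≤-trans (<⇒≤ k<) (m∸n≤m D uᵒ)
    ; gain<   = header< k (m≤m+n 2 6)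
    ; gain≡   = cong m₀ (fixed-address 1 k)
    ; loss<   = header< k (m≤m+n 3 5)
    ; loss≡   = cong m₀ (fixed-address 2 k)
    }

  encodes-work : ∀ k → k < D ∸ uʷ →
    Encodes (member b₀ (b₀ + 1 + uʷ) 2 0 3 0 k) k (suc (k + uʷ)) 0 (uʷ * N)
  encodes-work k k< = record
    { target≡ = refl
    ; source≡ = window uʷ k
    ; target≤ = ≤-trans (<⇒≤ k<) (m∸n≤m D uʷ)
    ; source≤ = window≤ k<
    ; gain<   = header< k (m≤m+n 3 5)
    ; gain≡   = cong m₀ (fixed-address 2 k)
    ; loss<   = header< k (m≤m+n 4 4)
    -- The stored product uses the minimum of `D` and `uʷ`; as the window fits into the `D` days,
    -- this minimum is `uʷ`.
    ; loss≡   = trans (cong m₀ (fixed-address 3 k)) (cong (_* N) (m∸[m∸n]≡n uʷ≤D))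
    }
    where
    uʷ≤D : uʷ ≤ D
    uʷ≤D = <⇒≤ (≤-trans (s≤s (m≤n+m uʷ k)) (window≤ k<))

  encodes-least : ∀ (k : Fin 1) →
    Encodes (member (b₀ + D) b₀ 7 0 2 0 (toℕ k)) D 0 ((D ∸ Uᵒ) * N) 0
  encodes-least zero = record
    { target≡ = +-identityʳ (b₀ + D)
    ; source≡ = refl
    ; target≤ = ≤-refl
    ; source≤ = z≤n
    ; gain<   = header< 0 (m≤m+n 8 0)
    ; gain≡   = refl
    ; loss<   = header< 0 (m≤m+n 3 5)
    ; loss≡   = refl
    }

  encodes-most : ∀ (k : Fin 1) →
    Encodes (member b₀ (b₀ + D) 2 0 6 0 (toℕ k)) 0 D 0 ((D ∸ (D ∸ Uʷ)) * N)
  encodes-most zero = record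
    { target≡ = refl
    ; source≡ = +-identityʳ (b₀ + D)
    ; target≤ = z≤n
    ; source≤ = ≤-refl
    ; gain<   = header< 0 (m≤m+n 3 5)
    ; gain≡   = refl
    ; loss<   = header< 0 (m≤m+n 7 1)
    ; loss≡   = refl
    }

  edges-wellFormed : All (WellFormed b₀ (suc D)) (edges I)
  edges-wellFormed =
    ++⁺ (strip⁺ D λ k → encodes⇒wellFormed (encodes-lower k))
    (++⁺ (strip⁺ D λ k → encodes⇒wellFormed (encodes-upper k))
    (++⁺ (strip⁺ (D ∸ uᵒ) λ k → encodes⇒wellFormed (encodes-off (toℕ k) (toℕ<n k)))
    (++⁺ (strip⁺ (D ∸ uʷ) λ k → encodes⇒wellFormed (encodes-work (toℕ k) (toℕ<n k)))
    (++⁺ (strip⁺ 1 λ k → encodes⇒wellFormed (encodes-least k))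
    (++⁺ (strip⁺ 1 λ k → encodes⇒wellFormed (encodes-most k)) [])))))

  module _ {z X : ℕ → ℕ}
           (low : ∀ x → x < b₀ → m₀ x ≡ z x) (high : ∀ d → z (b₀ + d) ≡ X d) where

    private
      satisfies≡ : ∀ {e t s g l} → Encodes e t s g l →
                   (X s + g ∸ l ≤ X t) ≡ Satisfies z e
      satisfies≡ enc = sym (cong₂ _≤_
        (cong₂ _∸_ (cong₂ _+_ (trans (cong z (source≡ enc)) (high _))
                              (trans (sym (low _ (gain< enc))) (gain≡ enc)))
                   (trans (sym (low _ (loss< enc))) (loss≡ enc)))
        (trans (cong z (target≡ enc)) (high _)))

      sat⁺ : ∀ {e t s g l} → Encodes e t s g l → X s + g ∸ l ≤ X t → Satisfies z e
      sat⁺ enc = subst (λ A → A) (satisfies≡ enc)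

      sat⁻ : ∀ {e t s g l} → Encodes e t s g l → Satisfies z e → X s + g ∸ l ≤ X t
      sat⁻ enc = subst (λ A → A) (sym (satisfies≡ enc))

    profile⇒solution : Profile I X → Solution (edges I) z
    profile⇒solution profile =
      ++⁺ (strip⁺ D λ k → sat⁺ (encodes-lower k) (lower k))
      (++⁺ (strip⁺ D λ k → sat⁺ (encodes-upper k) (lossy⁺ (rᵘ k) (upper k)))
      (++⁺ (strip⁺ (D ∸ uᵒ) λ k →
        sat⁺ (encodes-off (toℕ k) (toℕ<n k)) (off (toℕ k) (window≤ (toℕ<n k))))
      (++⁺ (strip⁺ (D ∸ uʷ) λ k →
        sat⁺ (encodes-work (toℕ k) (toℕ<n k))
          (lossy⁺ (uʷ * N) (work (toℕ k) (window≤ (toℕ<n k)))))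
      (++⁺ (strip⁺ 1 λ k → sat⁺ (encodes-least k) least)
      (++⁺ (strip⁺ 1 λ k → sat⁺ (encodes-most k) (lossy⁺ ((D ∸ (D ∸ Uʷ)) * N) most)) [])))))
      where open Profile profile

    solution⇒profile : Solution (edges I) z → Profile I X
    solution⇒profile sol₁ = record
      { lower = λ k → sat⁻ (encodes-lower k) (strip⁻ D (++⁻ˡ g₁ sol₁) k)
      ; upper = λ k → lossy⁻ (rᵘ k) (sat⁻ (encodes-upper k) (strip⁻ D (++⁻ˡ g₂ sol₂) k))
      ; off   = λ d le → let d< = m+n≤o⇒m≤o∸n (suc d) le in
          sat⁻ (encodes-off d d<) (subst (λ k → Satisfies z (member (b₀ + 1 + uᵒ) b₀ 1 0 2 0 k))
            (toℕ-fromℕ< d<) (strip⁻ (D ∸ uᵒ) (++⁻ˡ g₃ sol₃) (fromℕ< d<)))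
      ; work  = λ d le → let d< = m+n≤o⇒m≤o∸n (suc d) le in
          lossy⁻ (uʷ * N) (sat⁻ (encodes-work d d<)
            (subst (λ k → Satisfies z (member b₀ (b₀ + 1 + uʷ) 2 0 3 0 k))
              (toℕ-fromℕ< d<) (strip⁻ (D ∸ uʷ) (++⁻ˡ g₄ sol₄) (fromℕ< d<))))
      ; least = sat⁻ (encodes-least zero) (strip⁻ {i = 0} {0} 1 (++⁻ˡ g₅ sol₅) zero)
      ; most  = lossy⁻ ((D ∸ (D ∸ Uʷ)) * N)
                  (sat⁻ (encodes-most zero) (strip⁻ {i = 0} {0} 1 (++⁻ˡ g₆ sol₆) zero))
      }
      where
      g₁ = strip D (b₀ + 1) b₀ 8 1 2 0
      g₂ = strip D b₀ (b₀ + 1) 2 0 (8 + D) 1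
      g₃ = strip (D ∸ uᵒ) (b₀ + 1 + uᵒ) b₀ 1 0 2 0
      g₄ = strip (D ∸ uʷ) b₀ (b₀ + 1 + uʷ) 2 0 3 0
      g₅ = strip 1 (b₀ + D) b₀ 7 0 2 0
      g₆ = strip 1 b₀ (b₀ + D) 2 0 6 0
      sol₂ = ++⁻ʳ g₁ sol₁
      sol₃ = ++⁻ʳ g₂ sol₂
      sol₄ = ++⁻ʳ g₃ sol₃
      sol₅ = ++⁻ʳ g₄ sol₄
      sol₆ = ++⁻ʳ g₅ sol₅

  module _ (X : ℕ → ℕ) where

    -- Any profile, written behind the unchanged table, is a memory above the initial one: the
    -- solution with which the sweeps are compared.
    extend : Memory
    extend x = if does (x <? b₀) then m₀ x else X (x ∸ b₀)

    extend-low : ∀ x → x < b₀ → m₀ x ≡ extend x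
    extend-low x x<b rewrite dec-true (x <? b₀) x<b = refl

    extend-high : ∀ d → extend (b₀ + d) ≡ X d
    extend-high d rewrite dec-false (b₀ + d <? b₀) (≤⇒≯ (m≤m+n b₀ d)) = cong X (m+n∸m≡n b₀ d)

    table-⊑ : _⊑_ b₀ m₀ extend
    table-⊑ = below , extend-low
      where
      below : ∀ x → m₀ x ≤ extend x
      below x with <-≤-connex x b₀
      ... | inj₁ x<b = ≤-reflexive (extend-low x x<b)
      ... | inj₂ b≤x = subst (λ x → m₀ x ≤ extend x) (m+[n∸m]≡n b≤x)
                         (≤-trans (≤-reflexive (table-zero (x ∸ b₀))) z≤n)

  feasible⇒converged : HasFeasibleSchedule I →
                       increase (edges I) (iterate (edges I) (suc D) m₀) ≡ 0
  feasible⇒converged (f , feasible) with X , profile ← feasible⇒profile feasible =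
    Solution⇒increase≡0 (edges I) _
      (settles b₀ edges-wellFormed (table-⊑ X)
        (profile⇒solution (extend-low X) (extend-high X) profile))

  -- This direction is independent of convergence: a sweep without increase certifies that the
  -- memory before it is a solution, and the sweeps have left the weights intact, so a profile can
  -- be read off from `base` on.
  converged⇒feasible : OnlyUpperBounded I →
                       increase (edges I) (iterate (edges I) (suc D) m₀) ≡ 0 →
                       HasFeasibleSchedule I
  converged⇒feasible upper-only eq = profile⇒feasible upper-only
    (solution⇒profile (_⊑_.fixed (iterate-⊒ b₀ (suc D) m₀ edges-wellFormed)) (λ _ → refl)
      (increase≡0⇒Solution (edges I) _ eq))

answers : ∀ {p s₀} {Q : Set} {n T} → (Q → n ≡ 0) → (n ≡ 0 → Q) →
  ∃[ t ] ∃[ s ] ⟨ p , s₀ ⟩⇓[ t ] s × State.reg s 0 ≡ 1 ∸ n × t ≤ T →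
  ∃[ t ] ∃[ s ] ⟨ p , s₀ ⟩⇓[ t ] s × Answers Q s × t ≤ T
answers {n = zero}  Q⇒ ⇒Q (t , s , halts , verdict , t≤) =
  t , s , halts , inj₁ (⇒Q refl , verdict) , t≤
answers {n = suc n} Q⇒ ⇒Q (t , s , halts , verdict , t≤) =
  t , s , halts , inj₂ ((λ Q → 1+n≢0 (Q⇒ Q)) , trans verdict (0∸n≡0 n)) , t≤

theorem4p1 : DecidableInO {UDODOSP}
    (λ I → encode (proj₁ I))
    (λ I → HasFeasibleSchedule (proj₁ I))
    (λ I → DODOSP.D (proj₁ I) ^ 2)
theorem4p1 = decide , 640 , λ (I , upper-only) →
  answers {decide} {initial (encode I)} {HasFeasibleSchedule I}
    {increase (edges I) (iterate (edges I) (suc (DODOSP.D I)) (table I))}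
    {640 * DODOSP.D I ^ 2}
    (feasible⇒converged I) (converged⇒feasible I upper-only) (decide-⇓ I)
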